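{- There exists a $4$-dimensional convex polytope whose graph is isomorphic to the graph of the $5$-dimensional cube and which is not cubical.
   Context: A combinatorial cube is a polytope combinatorially equivalent to $[0,1]^k$ for some $k$. A polytope is cubical if all of its proper faces are combinatorial cubes. The graph of a polytope is the graph formed by its vertices and edges. -}

module Defs where

open import Level using (0ℓ)
open import Algebra.Bundles.Raw using (RawMonoid)
open import Data.Fin using (Fin)
open import Data.Nat as ℕ using (ℕ; suc)
import Data.Nat.Properties as ℕ
open import Data.Product using (Σ; ∃; ∃-syntax; _×_; _,_; proj₁)
open import Data.Rational as ℚ using (ℚ; 0ℚ; 1ℚ; ½; ∣_∣)
import Data.Rational.Properties as ℚ
open import Data.Vec.Functional using (Vector)
open import Relation.Binary.Core using (Rel)
open import Relation.Binary.Morphism.Structures using (IsOrderIsomorphism)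
open import Relation.Binary.PropositionalEquality using (_≡_; refl; sym; cong; subst)
open import Relation.Nullary using (¬_)
open import Relation.Nullary.Decidable.Core using (dec⇒maybe)
open import Relation.Unary using (Pred; _∈_; _⊆_; _≐_; Satisfiable)
open import Tactic.RingSolver using (solve-∀)
open import Tactic.RingSolver.Core.AlmostCommutativeRing
  using (AlmostCommutativeRing; fromCommutativeRing)

------------------------------------------------------------------------
-- Real numbers: Cauchy sequences of rationals, compared by _≈_

IsCauchy : (ℕ → ℚ) → Set
IsCauchy s = ∀ ε → 0ℚ ℚ.< ε →
  ∃[ N ] (∀ m n → N ℕ.≤ m → N ℕ.≤ n → ∣ s m ℚ.- s n ∣ ℚ.< ε)

record ℝ : Set where
  constructor mkℝ
  field
    seq    : ℕ → ℚ
    cauchy : IsCauchy seq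

open ℝ public

infix 4 _≈_ _<_ _≤_
infixl 6 _+_
infixl 7 _*_

record _≈_ (x y : ℝ) : Set where
  constructor mk≈
  field
    close : ∀ ε → 0ℚ ℚ.< ε →
      ∃[ N ] (∀ n → N ℕ.≤ n → ∣ seq x n ℚ.- seq y n ∣ ℚ.< ε)

record _<_ (x y : ℝ) : Set where
  constructor mk<
  field
    gap    : ℚ
    0<gap  : 0ℚ ℚ.< gap
    bound  : ℕ
    apart  : ∀ n → bound ℕ.≤ n → seq x n ℚ.+ gap ℚ.< seq y n

_≤_ : Rel ℝ 0ℓ
x ≤ y = ¬ (y < x)

fromℚ : ℚ → ℝ
fromℚ p = mkℝ (λ _ → p) λ ε 0<ε → 0 , λ _ _ _ _ →
  subst (ℚ._< ε) (cong ∣_∣ (sym (ℚ.+-inverseʳ p))) 0<ε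

0ℝ 1ℝ : ℝ
0ℝ = fromℚ 0ℚ
1ℝ = fromℚ 1ℚ

private
  0<* : ∀ {p q} → 0ℚ ℚ.< p → 0ℚ ℚ.< q → 0ℚ ℚ.< p ℚ.* q
  0<* {p} {q} 0<p 0<q = ℚ.positive⁻¹ (p ℚ.* q)
    where instance
      _ = ℚ.positive 0<p
      _ = ℚ.positive 0<q
      _ = ℚ.pos*pos⇒pos p q

  0<½ : 0ℚ ℚ.< ½
  0<½ = ℚ.positive⁻¹ ½

  -- Differences are spelled p + - q here because solve-∀ does not know ℚ._-_.
  ring : AlmostCommutativeRing 0ℓ 0ℓ
  ring = fromCommutativeRing ℚ.+-*-commutativeRing
    λ p → dec⇒maybe (0ℚ ℚ.≟ p)

  +-difference : ∀ a b c d →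
    (a ℚ.+ b) ℚ.+ ℚ.- (c ℚ.+ d) ≡ (a ℚ.+ ℚ.- c) ℚ.+ (b ℚ.+ ℚ.- d)
  +-difference = solve-∀ ring

  *-difference : ∀ a b c d →
    a ℚ.* b ℚ.+ ℚ.- (c ℚ.* d) ≡ a ℚ.* (b ℚ.+ ℚ.- d) ℚ.+ d ℚ.* (a ℚ.+ ℚ.- c)
  *-difference = solve-∀ ring

  cancel : ∀ a b → a ≡ (a ℚ.+ ℚ.- b) ℚ.+ b
  cancel = solve-∀ ring

  halves : ∀ ε → ½ ℚ.* ε ℚ.+ ½ ℚ.* ε ≡ ε
  halves ε = begin
    ½ ℚ.* ε ℚ.+ ½ ℚ.* ε  ≡⟨ ℚ.*-distribʳ-+ ε ½ ½ ⟨
    (½ ℚ.+ ½) ℚ.* ε      ≡⟨ cong (ℚ._* ε) (refl {x = 1ℚ}) ⟩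
    1ℚ ℚ.* ε             ≡⟨ ℚ.*-identityˡ ε ⟩
    ε                    ∎
    where open Relation.Binary.PropositionalEquality.≡-Reasoning

  eventuallyBounded : ∀ s → IsCauchy s →
    ∃[ B ] (0ℚ ℚ.< B × ∃[ N ] (∀ n → N ℕ.≤ n → ∣ s n ∣ ℚ.≤ B))
  eventuallyBounded s cs with cs 1ℚ (ℚ.positive⁻¹ 1ℚ)
  ... | N , hN =
      1ℚ ℚ.+ ∣ s N ∣
    , ℚ.+-mono-<-≤ (ℚ.positive⁻¹ 1ℚ) (ℚ.0≤∣p∣ (s N))
    , N , λ n n≥ → begin
      ∣ s n ∣                          ≡⟨ cong ∣_∣ (cancel (s n) (s N)) ⟩
      ∣ (s n ℚ.- s N) ℚ.+ s N ∣        ≤⟨ ℚ.∣p+q∣≤∣p∣+∣q∣ (s n ℚ.- s N) (s N) ⟩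
      ∣ s n ℚ.- s N ∣ ℚ.+ ∣ s N ∣      ≤⟨ ℚ.+-monoˡ-≤ ∣ s N ∣ (ℚ.<⇒≤ (hN n N n≥ ℕ.≤-refl)) ⟩
      1ℚ ℚ.+ ∣ s N ∣                   ∎
    where open ℚ.≤-Reasoning

  ∣*∣-bound : ∀ {B δ} a b → 0ℚ ℚ.< B → ∣ a ∣ ℚ.≤ B → ∣ b ∣ ℚ.< δ →
    ∣ a ℚ.* b ∣ ℚ.< B ℚ.* δ
  ∣*∣-bound {B} {δ} a b 0<B a≤B b<δ = begin-strict
    ∣ a ℚ.* b ∣      ≡⟨ ℚ.∣p*q∣≡∣p∣*∣q∣ a b ⟩
    ∣ a ∣ ℚ.* ∣ b ∣  ≤⟨ ℚ.*-monoʳ-≤-nonNeg ∣ b ∣ a≤B ⟩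
    B ℚ.* ∣ b ∣      <⟨ ℚ.*-monoʳ-<-pos B b<δ ⟩
    B ℚ.* δ          ∎
    where
      open ℚ.≤-Reasoning
      instance
        _ = ℚ.∣-∣-nonNeg b
        _ = ℚ.positive 0<B

  divide : ∀ {B ε} → 0ℚ ℚ.< B → 0ℚ ℚ.< ε → ∃[ δ ] (0ℚ ℚ.< δ × B ℚ.* δ ≡ ε)
  divide {B} {ε} 0<B 0<ε =
      ℚ.1/ B ℚ.* ε
    , 0<* (ℚ.positive⁻¹ (ℚ.1/ B) {{ℚ.1/pos⇒pos B}}) 0<ε
    , (begin
      B ℚ.* (ℚ.1/ B ℚ.* ε)  ≡⟨ ℚ.*-assoc B (ℚ.1/ B) ε ⟨
      (B ℚ.* ℚ.1/ B) ℚ.* ε  ≡⟨ cong (ℚ._* ε) (ℚ.*-inverseʳ B) ⟩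
      1ℚ ℚ.* ε              ≡⟨ ℚ.*-identityˡ ε ⟩
      ε                     ∎)
    where
      open Relation.Binary.PropositionalEquality.≡-Reasoning
      instance
        B-pos = ℚ.positive 0<B
        B-nonZero = ℚ.pos⇒nonZero B

  *-estimate : ∀ {A B δ} a b c d → 0ℚ ℚ.< A → 0ℚ ℚ.< B →
    ∣ a ∣ ℚ.≤ A → ∣ d ∣ ℚ.≤ B → ∣ a ℚ.- c ∣ ℚ.< δ → ∣ b ℚ.- d ∣ ℚ.< δ →
    ∣ a ℚ.* b ℚ.- c ℚ.* d ∣ ℚ.< (A ℚ.+ B) ℚ.* δ
  *-estimate {A} {B} {δ} a b c d 0<A 0<B a≤A d≤B a~c b~d = begin-strict
    ∣ a ℚ.* b ℚ.- c ℚ.* d ∣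
      ≡⟨ cong ∣_∣ (*-difference a b c d) ⟩
    ∣ a ℚ.* (b ℚ.- d) ℚ.+ d ℚ.* (a ℚ.- c) ∣
      ≤⟨ ℚ.∣p+q∣≤∣p∣+∣q∣ (a ℚ.* (b ℚ.- d)) (d ℚ.* (a ℚ.- c)) ⟩
    ∣ a ℚ.* (b ℚ.- d) ∣ ℚ.+ ∣ d ℚ.* (a ℚ.- c) ∣
      <⟨ ℚ.+-mono-< (∣*∣-bound a (b ℚ.- d) 0<A a≤A b~d)
                    (∣*∣-bound d (a ℚ.- c) 0<B d≤B a~c) ⟩
    A ℚ.* δ ℚ.+ B ℚ.* δ
      ≡⟨ ℚ.*-distribʳ-+ δ A B ⟨
    (A ℚ.+ B) ℚ.* δ
      ∎
    where open ℚ.≤-Reasoning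

  abstract
    +-cauchy : ∀ s t → IsCauchy s → IsCauchy t → IsCauchy (λ n → s n ℚ.+ t n)
    +-cauchy s t cs ct ε 0<ε
      with cs (½ ℚ.* ε) (0<* 0<½ 0<ε) | ct (½ ℚ.* ε) (0<* 0<½ 0<ε)
    ... | M , hM | N , hN = M ℕ.⊔ N , λ m n m≥ n≥ → begin-strict
      ∣ (s m ℚ.+ t m) ℚ.- (s n ℚ.+ t n) ∣
        ≡⟨ cong ∣_∣ (+-difference (s m) (t m) (s n) (t n)) ⟩
      ∣ (s m ℚ.- s n) ℚ.+ (t m ℚ.- t n) ∣
        ≤⟨ ℚ.∣p+q∣≤∣p∣+∣q∣ (s m ℚ.- s n) (t m ℚ.- t n) ⟩
      ∣ s m ℚ.- s n ∣ ℚ.+ ∣ t m ℚ.- t n ∣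
        <⟨ ℚ.+-mono-<
             (hM m n (ℕ.m⊔n≤o⇒m≤o M N m≥) (ℕ.m⊔n≤o⇒m≤o M N n≥))
             (hN m n (ℕ.m⊔n≤o⇒n≤o M N m≥) (ℕ.m⊔n≤o⇒n≤o M N n≥)) ⟩
      ½ ℚ.* ε ℚ.+ ½ ℚ.* ε
        ≡⟨ halves ε ⟩
      ε ∎
      where open ℚ.≤-Reasoning

    *-cauchy : ∀ s t → IsCauchy s → IsCauchy t → IsCauchy (λ n → s n ℚ.* t n)
    *-cauchy s t cs ct ε 0<ε =
      let A , 0<A , K , hK = eventuallyBounded s cs
          B , 0<B , L , hL = eventuallyBounded t ct
          δ , 0<δ , [A+B]δ≡ε = divide (ℚ.+-mono-< 0<A 0<B) 0<ε
          M , hM = cs δ 0<δ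
          N , hN = ct δ 0<δ
      in (K ℕ.⊔ L) ℕ.⊔ (M ℕ.⊔ N) , λ m n m≥ n≥ →
        let m≥KL = ℕ.m⊔n≤o⇒m≤o (K ℕ.⊔ L) (M ℕ.⊔ N) m≥
            n≥KL = ℕ.m⊔n≤o⇒m≤o (K ℕ.⊔ L) (M ℕ.⊔ N) n≥
            m≥MN = ℕ.m⊔n≤o⇒n≤o (K ℕ.⊔ L) (M ℕ.⊔ N) m≥
            n≥MN = ℕ.m⊔n≤o⇒n≤o (K ℕ.⊔ L) (M ℕ.⊔ N) n≥
        in subst (∣ s m ℚ.* t m ℚ.- s n ℚ.* t n ∣ ℚ.<_) [A+B]δ≡ε
          (*-estimate (s m) (t m) (s n) (t n) 0<A 0<B
            (hK m (ℕ.m⊔n≤o⇒m≤o K L m≥KL))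
            (hL n (ℕ.m⊔n≤o⇒n≤o K L n≥KL))
            (hM m n (ℕ.m⊔n≤o⇒m≤o M N m≥MN) (ℕ.m⊔n≤o⇒m≤o M N n≥MN))
            (hN m n (ℕ.m⊔n≤o⇒n≤o M N m≥MN) (ℕ.m⊔n≤o⇒n≤o M N n≥MN)))

_+_ _*_ : ℝ → ℝ → ℝ
x + y = mkℝ (λ n → seq x n ℚ.+ seq y n) (+-cauchy (seq x) (seq y) (cauchy x) (cauchy y))
x * y = mkℝ (λ n → seq x n ℚ.* seq y n) (*-cauchy (seq x) (seq y) (cauchy x) (cauchy y))

+-rawMonoid : RawMonoid 0ℓ 0ℓ
+-rawMonoid = record { Carrier = ℝ ; _≈_ = _≈_ ; _∙_ = _+_ ; ε = 0ℝ }

open import Algebra.Definitions.RawMonoid +-rawMonoid public using (sum)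

------------------------------------------------------------------------
-- Subsets of ℝⁿ

Point : ℕ → Set
Point n = Vector ℝ n

Subset : ℕ → Set₁
Subset n = Pred (Point n) 0ℓ

module _ {n : ℕ} where

  infix 4 _≋_
  infix 7 _·_

  _≋_ : Rel (Point n) 0ℓ
  x ≋ y = ∀ i → x i ≈ y i

  _·_ : Point n → Point n → ℝ
  c · x = sum λ i → c i * x i

  combination : ∀ {m} → Vector ℝ m → Vector (Point n) m → Point n
  combination w p j = sum λ i → w i * p i j

  Conv : ∀ {m} → Vector (Point n) m → Subset n
  Conv p x = ∃[ w ] ((∀ i → 0ℝ ≤ w i) × sum w ≈ 1ℝ × x ≋ combination w p)

  Aff : ∀ {m} → Vector (Point n) m → Subset n
  Aff p x = ∃[ w ] (sum w ≈ 1ℝ × x ≋ combination w p)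

  AffinelyIndependent : ∀ {m} → Vector (Point n) m → Set
  AffinelyIndependent p = ∀ w → sum w ≈ 0ℝ →
    combination w p ≋ (λ _ → 0ℝ) → ∀ i → w i ≈ 0ℝ

  -- The affine hull of S has dimension k: some k + 1 points of S form an
  -- affine basis of it.
  HasDimension : Subset n → ℕ → Set
  HasDimension S k = ∃[ p ]
    ((∀ (i : Fin (suc k)) → p i ∈ S) × AffinelyIndependent p × S ⊆ Aff p)

  IsPolytope : Subset n → Set
  IsPolytope P = Σ ℕ λ m → ∃[ p ] (P ≐ Conv {m} p)

------------------------------------------------------------------------
-- Faces

-- A face of P is P ∩ { x ∣ c · x = b } for an inequality c · x ≤ b valid
-- on P.  Both ∅ (0 · x ≤ 1) and P (0 · x ≤ 0) are faces.
record Face {n} (P : Subset n) : Set where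
  field
    normal : Point n
    offset : ℝ
    valid  : ∀ {x} → x ∈ P → normal · x ≤ offset

  points : Subset n
  points x = x ∈ P × normal · x ≈ offset

open Face public

module _ {n} {P : Subset n} where

  infix 4 _⊑_ _≗_

  _⊑_ : Rel (Face P) 0ℓ
  F ⊑ G = points F ⊆ points G

  -- Different inequalities may define the same face.
  _≗_ : Rel (Face P) 0ℓ
  F ≗ G = points F ≐ points G

  IsProper : Face P → Set
  IsProper F = ¬ (P ⊆ points F)

CombinatoriallyEquivalent : ∀ {m n} → Subset m → Subset n → Set
CombinatoriallyEquivalent P Q =
  Σ (Face P → Face Q) (IsOrderIsomorphism _≗_ _≗_ _⊑_ _⊑_)

------------------------------------------------------------------------
-- Cubes

Cube : ∀ k → Subset k
Cube k x = ∀ i → 0ℝ ≤ x i × x i ≤ 1ℝ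

IsCombinatorialCube : ∀ {n} → Subset n → Set
IsCombinatorialCube P = ∃[ k ] CombinatoriallyEquivalent P (Cube k)

-- The empty face is excluded: [0,1]ᵏ is never empty, so with it no
-- polytope would be cubical.
IsCubical : ∀ {n} → Subset n → Set
IsCubical P = (F : Face P) → Satisfiable (points F) → IsProper F →
  IsCombinatorialCube (points F)

------------------------------------------------------------------------
-- Graphs

module _ {n} (P : Subset n) where

  IsVertex : Point n → Set
  IsVertex x = Σ (Face P) λ F → HasDimension (points F) 0 × x ∈ points F

  Vertex : Set
  Vertex = ∃ IsVertex

  SameVertex : Rel Vertex 0ℓ
  SameVertex u v = proj₁ u ≋ proj₁ v

  Adjacent : Rel Vertex 0ℓ
  Adjacent u v = ¬ SameVertex u v × Σ (Face P) λ F →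
    HasDimension (points F) 1 × proj₁ u ∈ points F × proj₁ v ∈ points F

-- IsOrderIsomorphism asks for a bijection that preserves and reflects the
-- relation; nothing in it requires the relation to be an order.
GraphIsomorphic : ∀ {m n} → Subset m → Subset n → Set
GraphIsomorphic P Q = Σ (Vertex P → Vertex Q)
  (IsOrderIsomorphism (SameVertex P) (SameVertex Q) (Adjacent P) (Adjacent Q))

-- The polytope P is the convex hull of the 32 points (±X, ±X, y, z), where
-- (X, y, z) runs over the vertices of two quadrilaterals.  It is a deformation
-- of the cubical 4-polytope of Joswig and Ziegler with the graph of the 5-cube,
-- in which two cubes sharing a square have become coplanar.  The facet they
-- form is not a cube: a vertex of a cube spans the cube with only one other
-- vertex, but here some vertex spans the facet with two different ones.
--
-- An edge of P is exposed by the sum of the facet inequalities that are tight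
-- at its ends.  The segment joining two non-adjacent vertices crosses a segment
-- with an end at a third vertex, which therefore lies in every face containing
-- the two; such a face is not an edge, since no three vertices are collinear.

module Submission where

open import Level using (0ℓ)
open import Algebra.Bundles using (CommutativeRing)
open import Data.Bool.Base using (Bool; true; false; not; if_then_else_)
open import Data.Fin.Base using (Fin; zero; suc; finToFun; funToFin; combine; opposite)
open import Data.Fin.Patterns using (0F; 1F; 2F; 3F)
import Data.Fin.Properties as Fin
open import Data.Integer as ℤ using (ℤ; +_; -[1+_]; 0ℤ; 1ℤ; -1ℤ)
import Data.Integer.Properties as ℤ
open import Data.List.Base using (List; concatMap; foldr; filter; _++_)
  renaming ([] to []ˡ; _∷_ to infixr 5 _∷ˡ_)
import Data.List.Relation.Unary.All as List
open import Data.Nat as ℕ using (ℕ; zero; suc)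
import Data.Nat.Properties as ℕ
open import Data.Product using (Σ; ∃-syntax; _×_; _,_; proj₁; proj₂)
open import Data.Rational as ℚ using (ℚ; 0ℚ; 1ℚ; ½; ∣_∣)
import Data.Rational.Properties as ℚ
import Data.Rational.Unnormalised as ℚᵘ
import Data.Rational.Unnormalised.Properties as ℚᵘ
open import Data.Sum using (_⊎_; inj₁; inj₂; [_,_]′)
open import Data.Unit.Base using (⊤; tt)
open import Data.Vec.Base as Vec using (Vec)
  renaming ([] to []ᵛ; _∷_ to infixr 5 _∷ᵛ_)
open import Data.Vec.Functional using (Vector; []; _∷_)
import Data.Vec.Properties as Vec
open import Function using (_∘_)
open import Relation.Binary.Core using (Rel)
open import Relation.Binary.Definitions using (Decidable; Irreflexive)
open import Relation.Binary.Morphism.Structures using (IsOrderIsomorphism)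
open import Relation.Binary.PropositionalEquality as ≡
  using (_≡_; _≢_; refl; sym; trans; cong; cong₂; subst; subst₂)
import Relation.Binary.Reasoning.Setoid as SetoidReasoning
open import Relation.Binary.Structures using (IsEquivalence)
open import Relation.Nullary using (¬_; Dec; yes; no; does; contradiction)
open import Relation.Nullary.Decidable
  using (dec-true; map′; toWitness; ¬?; _×-dec_; _⊎-dec_; _→-dec_)
open import Relation.Nullary.Decidable.Core using (dec⇒maybe)
open import Relation.Unary using (Pred; _∈_; _⊆_; _∩_)
open import Tactic.RingSolver using (solve-∀)
open import Tactic.RingSolver.Core.AlmostCommutativeRing
  using (AlmostCommutativeRing; fromCommutativeRing)
open import Defs

-- Null sequences of rationals

-- The reals are constructive, which shapes most arguments: `x ≤ y` is the negation of `y < x`,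
-- order and equality cannot be decided, and a case distinction must come from cotransitivity
-- (`<-split`, `0<+⇒0<⊎0<`) or from integer data. Faces are therefore handled through the slack
-- `b - c · x`, nonnegative on the polytope and zero on the face. For P, incidences reduce to
-- integer identities and integer signs at the 32 vertices, decided by evaluation. The recurring
-- argument: if a sum of nonnegative terms `α k * slack (x k)` vanishes, each term vanishes. The
-- graphs are compared through one abstract graph on labels, words at Hamming distance one, so no
-- geometric map between the polytopes occurs. A combinatorial equivalence with a cube transports
-- only the order of faces; vertices must therefore be recognised as minimal nonempty faces, and
-- nonemptiness is available only as a double negation.

ℚ-ring : AlmostCommutativeRing 0ℓ 0ℓ
ℚ-ring = fromCommutativeRing ℚ.+-*-commutativeRing λ p → dec⇒maybe (0ℚ ℚ.≟ p)

0<p*q : ∀ {p q} → 0ℚ ℚ.< p → 0ℚ ℚ.< q → 0ℚ ℚ.< p ℚ.* q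
0<p*q {p} {q} 0<p 0<q = ℚ.positive⁻¹ (p ℚ.* q) {{ℚ.pos*pos⇒pos p {{ℚ.positive 0<p}} q {{ℚ.positive 0<q}}}}

0<½*_ : ∀ {ε} → 0ℚ ℚ.< ε → 0ℚ ℚ.< ½ ℚ.* ε
0<½* 0<ε = 0<p*q (ℚ.positive⁻¹ ½) 0<ε

½*ε+½*ε≡ε : ∀ ε → ½ ℚ.* ε ℚ.+ ½ ℚ.* ε ≡ ε
½*ε+½*ε≡ε ε = begin
  ½ ℚ.* ε ℚ.+ ½ ℚ.* ε  ≡⟨ ℚ.*-distribʳ-+ ε ½ ½ ⟨
  1ℚ ℚ.* ε             ≡⟨ ℚ.*-identityˡ ε ⟩
  ε                    ∎
  where open ≡.≡-Reasoning

Null : (ℕ → ℚ) → Set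
Null s = ∀ ε → 0ℚ ℚ.< ε → ∃[ N ] (∀ n → N ℕ.≤ n → ∣ s n ∣ ℚ.< ε)

Bounded : (ℕ → ℚ) → Set
Bounded s = ∃[ B ] (0ℚ ℚ.< B × ∃[ N ] (∀ n → N ℕ.≤ n → ∣ s n ∣ ℚ.≤ B))

null-cong : ∀ {s t} → (∀ n → s n ≡ t n) → Null s → Null t
null-cong s≗t s→0 ε 0<ε with s→0 ε 0<ε
... | N , small = N , λ n N≤n → subst (λ q → ∣ q ∣ ℚ.< ε) (s≗t n) (small n N≤n)

null-0 : Null (λ _ → 0ℚ)
null-0 ε 0<ε = 0 , λ _ _ → 0<ε

null-neg : ∀ {s} → Null s → Null (λ n → ℚ.- s n)
null-neg {s} s→0 ε 0<ε with s→0 ε 0<ε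
... | N , small = N , λ n N≤n → subst (ℚ._< ε) (sym (ℚ.∣-p∣≡∣p∣ (s n))) (small n N≤n)

null-+ : ∀ {s t} → Null s → Null t → Null (λ n → s n ℚ.+ t n)
null-+ {s} {t} s→0 t→0 ε 0<ε
  with s→0 (½ ℚ.* ε) (0<½* 0<ε) | t→0 (½ ℚ.* ε) (0<½* 0<ε)
... | M , s-small | N , t-small = M ℕ.⊔ N , λ n ≤n → begin-strict
  ∣ s n ℚ.+ t n ∣      ≤⟨ ℚ.∣p+q∣≤∣p∣+∣q∣ (s n) (t n) ⟩
  ∣ s n ∣ ℚ.+ ∣ t n ∣  <⟨ ℚ.+-mono-< (s-small n (ℕ.m⊔n≤o⇒m≤o M N ≤n))
                                     (t-small n (ℕ.m⊔n≤o⇒n≤o M N ≤n)) ⟩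
  ½ ℚ.* ε ℚ.+ ½ ℚ.* ε  ≡⟨ ½*ε+½*ε≡ε ε ⟩
  ε                    ∎
  where open ℚ.≤-Reasoning

null-* : ∀ s {t} → Bounded s → Null t → Null (λ n → s n ℚ.* t n)
null-* s {t} (B , 0<B , M , s-bounded) t→0 ε 0<ε = M ℕ.⊔ N , λ n ≤n → begin-strict
  ∣ s n ℚ.* t n ∣         ≡⟨ ℚ.∣p*q∣≡∣p∣*∣q∣ (s n) (t n) ⟩
  ∣ s n ∣ ℚ.* ∣ t n ∣     ≤⟨ ℚ.*-monoʳ-≤-nonNeg ∣ t n ∣ {{ℚ.∣-∣-nonNeg (t n)}}
                               (s-bounded n (ℕ.m⊔n≤o⇒m≤o M N ≤n)) ⟩
  B ℚ.* ∣ t n ∣           <⟨ ℚ.*-monoʳ-<-pos B (t-small n (ℕ.m⊔n≤o⇒n≤o M N ≤n)) ⟩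
  B ℚ.* (ℚ.1/ B ℚ.* ε)    ≡⟨ ℚ.*-assoc B (ℚ.1/ B) ε ⟨
  (B ℚ.* ℚ.1/ B) ℚ.* ε    ≡⟨ cong (ℚ._* ε) (ℚ.*-inverseʳ B) ⟩
  1ℚ ℚ.* ε                ≡⟨ ℚ.*-identityˡ ε ⟩
  ε                       ∎
  where
  open ℚ.≤-Reasoning
  instance
    B-positive = ℚ.positive 0<B
    B-nonZero = ℚ.pos⇒nonZero B
    1/B-positive = ℚ.1/pos⇒pos B
  eventually = t→0 (ℚ.1/ B ℚ.* ε)
    (0<p*q (ℚ.positive⁻¹ (ℚ.1/ B)) 0<ε)
  N = proj₁ eventually
  t-small = proj₂ eventually

seq-bounded : ∀ x → Bounded (seq x)
seq-bounded x with cauchy x 1ℚ (ℚ.positive⁻¹ 1ℚ)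
... | N , near = 1ℚ ℚ.+ ∣ seq x N ∣
  , ℚ.+-mono-<-≤ (ℚ.positive⁻¹ 1ℚ) (ℚ.0≤∣p∣ (seq x N))
  , N , λ n N≤n → begin
    ∣ s n ∣                      ≡⟨ cong ∣_∣ (split (s n) (s N)) ⟩
    ∣ (s n ℚ.- s N) ℚ.+ s N ∣    ≤⟨ ℚ.∣p+q∣≤∣p∣+∣q∣ (s n ℚ.- s N) (s N) ⟩
    ∣ s n ℚ.- s N ∣ ℚ.+ ∣ s N ∣  ≤⟨ ℚ.+-monoˡ-≤ ∣ s N ∣ (ℚ.<⇒≤ (near n N N≤n ℕ.≤-refl)) ⟩
    1ℚ ℚ.+ ∣ s N ∣               ∎
  where
  open ℚ.≤-Reasoning
  s = seq x
  split : ∀ p q → p ≡ (p ℚ.+ ℚ.- q) ℚ.+ q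
  split = solve-∀ ℚ-ring

-- The ring of real numbers

infix 8 -_

-_ : ℝ → ℝ
- x = mkℝ (λ n → ℚ.- seq x n) λ ε 0<ε →
  let N , near = cauchy x ε 0<ε in N , λ m n N≤m N≤n →
  subst (ℚ._< ε) (trans (sym (ℚ.∣-p∣≡∣p∣ (seq x m ℚ.- seq x n)))
                        (cong ∣_∣ (ℚ.neg-distrib-+ (seq x m) (ℚ.- seq x n))))
    (near m n N≤m N≤n)

-- The ring operations act termwise, so a polynomial identity over ℝ follows from the same identity
-- over ℚ at each index. This is how the ring solver for ℚ serves the reals below.
≗⇒≈ : ∀ {x y} → (∀ n → seq x n ≡ seq y n) → x ≈ y
≗⇒≈ {x} {y} x≗y = mk≈ (null-cong
  (λ n → trans (sym (ℚ.+-inverseʳ (seq x n))) (cong (λ q → seq x n ℚ.- q) (x≗y n))) null-0)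

≈-isEquivalence : IsEquivalence _≈_
≈-isEquivalence = record
  { refl  = ≗⇒≈ λ _ → refl
  ; sym   = λ {x} {y} (mk≈ x≈y) → mk≈ (null-cong (λ n → swap (seq x n) (seq y n)) (null-neg x≈y))
  ; trans = λ {x} {y} {z} (mk≈ x≈y) (mk≈ y≈z) →
      mk≈ (null-cong (λ n → chain (seq x n) (seq y n) (seq z n)) (null-+ x≈y y≈z))
  }
  where
  swap : ∀ p q → ℚ.- (p ℚ.+ ℚ.- q) ≡ q ℚ.+ ℚ.- p
  swap = solve-∀ ℚ-ring
  chain : ∀ p q r → (p ℚ.+ ℚ.- q) ℚ.+ (q ℚ.+ ℚ.- r) ≡ p ℚ.+ ℚ.- r
  chain = solve-∀ ℚ-ring

+-cong : ∀ {x y u v} → x ≈ y → u ≈ v → x + u ≈ y + v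
+-cong {x} {y} {u} {v} (mk≈ x≈y) (mk≈ u≈v) = mk≈ (null-cong
  (λ n → regroup (seq x n) (seq y n) (seq u n) (seq v n)) (null-+ x≈y u≈v))
  where
  regroup : ∀ x y u v → (x ℚ.+ ℚ.- y) ℚ.+ (u ℚ.+ ℚ.- v) ≡ (x ℚ.+ u) ℚ.+ ℚ.- (y ℚ.+ v)
  regroup = solve-∀ ℚ-ring

*-cong : ∀ {x y u v} → x ≈ y → u ≈ v → x * u ≈ y * v
*-cong {x} {y} {u} {v} (mk≈ x≈y) (mk≈ u≈v) = mk≈ (null-cong
  (λ n → regroup (seq x n) (seq y n) (seq u n) (seq v n))
  (null-+ (null-* (seq x) (seq-bounded x) u≈v) (null-* (seq v) (seq-bounded v) x≈y)))
  where
  regroup : ∀ x y u v → x ℚ.* (u ℚ.+ ℚ.- v) ℚ.+ v ℚ.* (x ℚ.+ ℚ.- y) ≡ x ℚ.* u ℚ.+ ℚ.- (y ℚ.* v)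
  regroup = solve-∀ ℚ-ring

-‿cong : ∀ {x y} → x ≈ y → - x ≈ - y
-‿cong {x} {y} (mk≈ x≈y) = mk≈ (null-cong
  (λ n → ℚ.neg-distrib-+ (seq x n) (ℚ.- seq y n)) (null-neg x≈y))

ℝ-commutativeRing : CommutativeRing 0ℓ 0ℓ
ℝ-commutativeRing = record
  { Carrier = ℝ ; _≈_ = _≈_ ; _+_ = _+_ ; _*_ = _*_ ; -_ = -_ ; 0# = 0ℝ ; 1# = 1ℝ
  ; isCommutativeRing = record
    { isRing = record
      { +-isAbelianGroup = record
        { isGroup = record
          { isMonoid = record
            { isSemigroup = record
              { isMagma = record { isEquivalence = ≈-isEquivalence ; ∙-cong = +-cong }
              ; assoc = λ x y z → ≗⇒≈ λ n → ℚ.+-assoc (seq x n) (seq y n) (seq z n) }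
            ; identity = (λ x → ≗⇒≈ λ n → ℚ.+-identityˡ (seq x n))
                       , (λ x → ≗⇒≈ λ n → ℚ.+-identityʳ (seq x n)) }
          ; inverse = (λ x → ≗⇒≈ λ n → ℚ.+-inverseˡ (seq x n))
                    , (λ x → ≗⇒≈ λ n → ℚ.+-inverseʳ (seq x n))
          ; ⁻¹-cong = -‿cong }
        ; comm = λ x y → ≗⇒≈ λ n → ℚ.+-comm (seq x n) (seq y n) }
      ; *-cong = *-cong
      ; *-assoc = λ x y z → ≗⇒≈ λ n → ℚ.*-assoc (seq x n) (seq y n) (seq z n)
      ; *-identity = (λ x → ≗⇒≈ λ n → ℚ.*-identityˡ (seq x n))
                   , (λ x → ≗⇒≈ λ n → ℚ.*-identityʳ (seq x n))
      ; distrib = (λ x y z → ≗⇒≈ λ n → ℚ.*-distribˡ-+ (seq x n) (seq y n) (seq z n))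
                , (λ x y z → ≗⇒≈ λ n → ℚ.*-distribʳ-+ (seq x n) (seq y n) (seq z n)) }
    ; *-comm = λ x y → ≗⇒≈ λ n → ℚ.*-comm (seq x n) (seq y n) } }

open CommutativeRing ℝ-commutativeRing
  using (_-_; setoid; +-identityˡ; +-identityʳ; *-identityˡ; +-comm; *-comm; *-assoc; distribʳ
        ; zeroˡ; zeroʳ; -‿inverseʳ)
  renaming (refl to ≈-refl; sym to ≈-sym; trans to ≈-trans; reflexive to ≈-reflexive)
open import Algebra.Properties.Ring (CommutativeRing.ring ℝ-commutativeRing)
  using (-0#≈0#; -‿involutive; -‿+-comm; -‿distribʳ-*; -‿distribˡ-*; x[y-z]≈xy-xz
        ; x∙y⁻¹≈ε⇒x≈y; x≈y⇒x∙y⁻¹≈ε; ⁻¹-anti-homo-//; //-rightDividesʳ)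
open import Algebra.Properties.Semiring.Sum (CommutativeRing.semiring ℝ-commutativeRing)
  using (sum-cong-≋; ∑-distrib-+; ∑-comm; sum-replicate-zero; *-distribˡ-sum; *-distribʳ-sum)
open import Algebra.Properties.Semiring.Sum (CommutativeRing.semiring ℤ.+-*-commutativeRing)
  using () renaming (sum to sumℤ)

-- The order of the real numbers

eventually₂ : ∀ {P Q R : ℕ → Set} → ∃[ M ] (∀ n → M ℕ.≤ n → P n) → ∃[ N ] (∀ n → N ℕ.≤ n → Q n) →
  (∀ n → P n → Q n → R n) → ∃[ K ] (∀ n → K ℕ.≤ n → R n)
eventually₂ (M , p) (N , q) r = M ℕ.⊔ N , λ n ≤n →
  r n (p n (ℕ.m⊔n≤o⇒m≤o M N ≤n)) (q n (ℕ.m⊔n≤o⇒n≤o M N ≤n))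

p<q+[p-q] : ∀ {ε} p q → ∣ p ℚ.- q ∣ ℚ.< ε → p ℚ.< q ℚ.+ ε
p<q+[p-q] {ε} p q near = begin-strict
  p                    ≡⟨ split p q ⟩
  q ℚ.+ (p ℚ.- q)      ≤⟨ ℚ.+-monoʳ-≤ q (p≤∣p∣ (p ℚ.- q)) ⟩
  q ℚ.+ ∣ p ℚ.- q ∣    <⟨ ℚ.+-monoʳ-< q near ⟩
  q ℚ.+ ε              ∎
  where
  open ℚ.≤-Reasoning
  split : ∀ p q → p ≡ q ℚ.+ (p ℚ.+ ℚ.- q)
  split = solve-∀ ℚ-ring
  p≤∣p∣ : ∀ p → p ℚ.≤ ∣ p ∣
  p≤∣p∣ p with ℚ.≤-total 0ℚ p
  ... | inj₁ 0≤p = ℚ.≤-reflexive (sym (ℚ.0≤p⇒∣p∣≡p 0≤p))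
  ... | inj₂ p≤0 = ℚ.≤-trans p≤0 (ℚ.0≤∣p∣ p)

ℚ+-cancelʳ-< : ∀ r p q → p ℚ.+ r ℚ.< q ℚ.+ r → p ℚ.< q
ℚ+-cancelʳ-< r p q p+r<q+r = ℚ.≰⇒> λ q≤p → ℚ.<-irrefl refl (ℚ.<-≤-trans p+r<q+r (ℚ.+-monoˡ-≤ r q≤p))

ℚ+-cancelˡ-< : ∀ r p q → r ℚ.+ p ℚ.< r ℚ.+ q → p ℚ.< q
ℚ+-cancelˡ-< r p q = ℚ+-cancelʳ-< r p q ∘ subst₂ ℚ._<_ (ℚ.+-comm r p) (ℚ.+-comm r q)

<⇒0<- : ∀ {x y} → x < y → 0ℝ < y - x
<⇒0<- {x} {y} (mk< g 0<g N x+g<y) = mk< g 0<g N λ n N≤n →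
  subst (ℚ._< seq y n ℚ.- seq x n) (cancel (seq x n) g)
    (ℚ.+-monoˡ-< (ℚ.- seq x n) (x+g<y n N≤n))
  where
  cancel : ∀ x g → (x ℚ.+ g) ℚ.+ ℚ.- x ≡ 0ℚ ℚ.+ g
  cancel = solve-∀ ℚ-ring

0<-⇒< : ∀ {x y} → 0ℝ < y - x → x < y
0<-⇒< {x} {y} (mk< g 0<g N g<y-x) = mk< g 0<g N λ n N≤n →
  subst₂ ℚ._<_ (left (seq x n) g) (right (seq x n) (seq y n))
    (ℚ.+-monoˡ-< (seq x n) (g<y-x n N≤n))
  where
  left : ∀ x g → (0ℚ ℚ.+ g) ℚ.+ x ≡ x ℚ.+ g
  left = solve-∀ ℚ-ring
  right : ∀ x y → (y ℚ.+ ℚ.- x) ℚ.+ x ≡ y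
  right = solve-∀ ℚ-ring

0<-resp-≈ : ∀ {x y} → x ≈ y → 0ℝ < x → 0ℝ < y
0<-resp-≈ {x} {y} (mk≈ x≈y) (mk< g 0<g N g<x) =
  let K , ½g<y = eventually₂ (N , g<x) (x≈y (½ ℚ.* g) (0<½* 0<g)) λ n g<x near →
        ℚ+-cancelʳ-< (½ ℚ.* g) (0ℚ ℚ.+ ½ ℚ.* g) (seq y n) (begin-strict
          (0ℚ ℚ.+ ½ ℚ.* g) ℚ.+ ½ ℚ.* g  ≡⟨ ℚ.+-assoc 0ℚ (½ ℚ.* g) (½ ℚ.* g) ⟩
          0ℚ ℚ.+ (½ ℚ.* g ℚ.+ ½ ℚ.* g)  ≡⟨ cong (0ℚ ℚ.+_) (½*ε+½*ε≡ε g) ⟩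
          0ℚ ℚ.+ g                      <⟨ g<x ⟩
          seq x n                       <⟨ p<q+[p-q] (seq x n) (seq y n) near ⟩
          seq y n ℚ.+ ½ ℚ.* g           ∎)
  in mk< (½ ℚ.* g) (0<½* 0<g) K ½g<y
  where open ℚ.≤-Reasoning

<-resp-≈ : ∀ {x y u v} → x ≈ y → u ≈ v → x < u → y < v
<-resp-≈ x≈y u≈v x<u = 0<-⇒< (0<-resp-≈ (+-cong u≈v (-‿cong x≈y)) (<⇒0<- x<u))

x≮x : ∀ {x} → ¬ x < x
x≮x {x} (mk< g 0<g N x+g<x) = ℚ.<-asym 0<g (ℚ+-cancelˡ-< (seq x N) g 0ℚ
  (subst (seq x N ℚ.+ g ℚ.<_) (sym (ℚ.+-identityʳ (seq x N))) (x+g<x N ℕ.≤-refl)))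

<-irrefl : ∀ {x y} → x ≈ y → ¬ x < y
<-irrefl x≈y x<y = x≮x (<-resp-≈ x≈y ≈-refl x<y)

-- The decision is made on a single term `seq x N`, from which later terms differ by less than `δ`,
-- a quarter of `q - p`. A term at most the midpoint keeps x below q with gap `δ`; a term above it
-- keeps x above p with gap `δ`.
<-split : ∀ {p q} x → p ℚ.< q → fromℚ p < x ⊎ x < fromℚ q
<-split {p} {q} x p<q = choose (ℚ._≤?_ (seq x N) (p ℚ.+ (δ ℚ.+ δ)))
  where
  open ℚ.≤-Reasoning
  δ = ½ ℚ.* (½ ℚ.* (q ℚ.- p))
  0<δ : 0ℚ ℚ.< δ
  0<δ = 0<½* 0<½* subst (ℚ._< q ℚ.- p) (ℚ.+-inverseʳ p) (ℚ.+-monoˡ-< (ℚ.- p) p<q)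
  N = proj₁ (cauchy x δ 0<δ)
  near = proj₂ (cauchy x δ 0<δ)
  quarters : p ℚ.+ (δ ℚ.+ δ) ℚ.+ (δ ℚ.+ δ) ≡ q
  quarters = begin-equality
    p ℚ.+ (δ ℚ.+ δ) ℚ.+ (δ ℚ.+ δ)
      ≡⟨ cong (λ η → p ℚ.+ η ℚ.+ η) (½*ε+½*ε≡ε (½ ℚ.* (q ℚ.- p))) ⟩
    p ℚ.+ ½ ℚ.* (q ℚ.- p) ℚ.+ ½ ℚ.* (q ℚ.- p)
      ≡⟨ ℚ.+-assoc p (½ ℚ.* (q ℚ.- p)) (½ ℚ.* (q ℚ.- p)) ⟩
    p ℚ.+ (½ ℚ.* (q ℚ.- p) ℚ.+ ½ ℚ.* (q ℚ.- p))
      ≡⟨ cong (p ℚ.+_) (½*ε+½*ε≡ε (q ℚ.- p)) ⟩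
    p ℚ.+ (q ℚ.- p)
      ≡⟨ recombine p q ⟩
    q ∎
    where
    recombine : ∀ p q → p ℚ.+ (q ℚ.+ ℚ.- p) ≡ q
    recombine = solve-∀ ℚ-ring
  choose : _ → _
  choose (yes xN≤mid) = inj₂ (mk< δ 0<δ N λ n N≤n → begin-strict
    seq x n ℚ.+ δ                     <⟨ ℚ.+-monoˡ-< δ (p<q+[p-q] (seq x n) (seq x N) (near n N N≤n ℕ.≤-refl)) ⟩
    (seq x N ℚ.+ δ) ℚ.+ δ             ≡⟨ ℚ.+-assoc (seq x N) δ δ ⟩
    seq x N ℚ.+ (δ ℚ.+ δ)             ≤⟨ ℚ.+-monoˡ-≤ (δ ℚ.+ δ) xN≤mid ⟩
    p ℚ.+ (δ ℚ.+ δ) ℚ.+ (δ ℚ.+ δ)     ≡⟨ quarters ⟩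
    q                                 ∎)
  choose (no xN≰mid) = inj₁ (mk< δ 0<δ N λ n N≤n → ℚ+-cancelʳ-< δ (p ℚ.+ δ) (seq x n) (begin-strict
    (p ℚ.+ δ) ℚ.+ δ                   ≡⟨ ℚ.+-assoc p δ δ ⟩
    p ℚ.+ (δ ℚ.+ δ)                   <⟨ ℚ.≰⇒> xN≰mid ⟩
    seq x N                           <⟨ p<q+[p-q] (seq x N) (seq x n) (near N n ℕ.≤-refl N≤n) ⟩
    seq x n ℚ.+ δ                     ∎))

-- Splitting y at 0 and ε turns the refutation of `0 < y` into the positive fact that y is
-- eventually below ε; this is applied to x and to `- x`.
¬≷⇒≈0 : ∀ {x} → ¬ 0ℝ < x → ¬ 0ℝ < - x → x ≈ 0ℝ
¬≷⇒≈0 {x} x≯0 x≮0 = mk≈ λ ε 0<ε → eventually₂ (below x x≯0 ε 0<ε) (below (- x) x≮0 ε 0<ε) λ n x<ε -x<ε →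
  subst (λ q → ∣ q ∣ ℚ.< ε) (sym (ℚ.+-identityʳ (seq x n))) (abs< x<ε -x<ε)
  where
  abs< : ∀ {p ε} → p ℚ.< ε → ℚ.- p ℚ.< ε → ∣ p ∣ ℚ.< ε
  abs< {p} p<ε -p<ε with ℚ.∣p∣≡p∨∣p∣≡-p p
  ... | inj₁ ∣p∣≡p  = subst (ℚ._< _) (sym ∣p∣≡p) p<ε
  ... | inj₂ ∣p∣≡-p = subst (ℚ._< _) (sym ∣p∣≡-p) -p<ε
  below : ∀ y → ¬ 0ℝ < y → ∀ ε → 0ℚ ℚ.< ε → ∃[ N ] (∀ n → N ℕ.≤ n → seq y n ℚ.< ε)
  below y y≯0 ε 0<ε with <-split y 0<ε
  ... | inj₁ 0<y = contradiction 0<y y≯0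
  ... | inj₂ (mk< g 0<g N y+g<ε) = N , λ n N≤n → ℚ.<-trans
    (subst (ℚ._< seq y n ℚ.+ g) (ℚ.+-identityʳ (seq y n)) (ℚ.+-monoʳ-< (seq y n) 0<g)) (y+g<ε n N≤n)

-- The rational gap g of the sum makes the choice possible: x is compared with 0 and g, and if
-- `x < g` by a margin h, then y is eventually above h.
0<+⇒0<⊎0< : ∀ {x y} → 0ℝ < x + y → 0ℝ < x ⊎ 0ℝ < y
0<+⇒0<⊎0< {x} {y} (mk< g 0<g N g<x+y) with <-split x 0<g
... | inj₁ 0<x = inj₁ 0<x
... | inj₂ (mk< h 0<h M x+h<g) = inj₂ (mk< h 0<h (N ℕ.⊔ M) λ n ≤n →
  ℚ+-cancelˡ-< (seq x n) (0ℚ ℚ.+ h) (seq y n) (begin-strict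
    seq x n ℚ.+ (0ℚ ℚ.+ h)  ≡⟨ cong (seq x n ℚ.+_) (ℚ.+-identityˡ h) ⟩
    seq x n ℚ.+ h           <⟨ x+h<g n (ℕ.m⊔n≤o⇒n≤o N M ≤n) ⟩
    g                       ≡⟨ ℚ.+-identityˡ g ⟨
    0ℚ ℚ.+ g                <⟨ g<x+y n (ℕ.m⊔n≤o⇒m≤o N M ≤n) ⟩
    seq x n ℚ.+ seq y n     ∎))
  where open ℚ.≤-Reasoning

0<* : ∀ {x y} → 0ℝ < x → 0ℝ < y → 0ℝ < x * y
0<* {x} {y} (mk< g 0<g M g<x) (mk< h 0<h N h<y) =
  let K , gh<xy = eventually₂ (M , g<x) (N , h<y) λ n g<x h<y → begin-strict
        0ℚ ℚ.+ g ℚ.* h     ≡⟨ ℚ.+-identityˡ (g ℚ.* h) ⟩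
        g ℚ.* h            <⟨ ℚ.*-monoʳ-<-pos g {{ℚ.positive 0<g}} (drop-0 h (seq y n) h<y) ⟩
        g ℚ.* seq y n      <⟨ ℚ.*-monoˡ-<-pos (seq y n) {{ℚ.positive (ℚ.<-trans 0<h (drop-0 h (seq y n) h<y))}} (drop-0 g (seq x n) g<x) ⟩
        seq x n ℚ.* seq y n ∎
  in mk< (g ℚ.* h) (0<p*q 0<g 0<h) K gh<xy
  where
  open ℚ.≤-Reasoning
  drop-0 : ∀ p q → 0ℚ ℚ.+ p ℚ.< q → p ℚ.< q
  drop-0 p q = subst (ℚ._< q) (ℚ.+-identityˡ p)

-- Signs of sums and products

module ≈-Reasoning = SetoidReasoning setoid

0<1 : 0ℝ < 1ℝ
0<1 = mk< ½ (ℚ.positive⁻¹ ½) 0 λ _ _ → ℚ.*<* (ℤ.+<+ (ℕ.s≤s (ℕ.s≤s ℕ.z≤n)))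

0≤⇒≮0 : ∀ {x} → 0ℝ ≤ x → ¬ 0ℝ < - x
0≤⇒≮0 0≤x 0<-x = 0≤x (0<-⇒< (0<-resp-≈ (≈-sym (+-identityˡ _)) 0<-x))

≮0⇒0≤ : ∀ {x} → ¬ 0ℝ < - x → 0ℝ ≤ x
≮0⇒0≤ x≮0 x<0 = x≮0 (0<-resp-≈ (+-identityˡ _) (<⇒0<- x<0))

0≤-resp-≈ : ∀ {x y} → x ≈ y → 0ℝ ≤ x → 0ℝ ≤ y
0≤-resp-≈ x≈y 0≤x y<0 = 0≤x (<-resp-≈ (≈-sym x≈y) ≈-refl y<0)

≈⇒0≤ : ∀ {x} → x ≈ 0ℝ → 0ℝ ≤ x
≈⇒0≤ x≈0 = <-irrefl x≈0

<⇒0≤ : ∀ {x} → 0ℝ < x → 0ℝ ≤ x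
<⇒0≤ {x} 0<x = ≮0⇒0≤ λ 0<-x → x≮x (0<-resp-≈ (-‿inverseʳ x) (0<+ 0<x 0<-x))
  where
  0<+ : ∀ {x y} → 0ℝ < x → 0ℝ < y → 0ℝ < x + y
  0<+ {x} {y} (mk< g 0<g M g<x) (mk< h 0<h N h<y) =
    let K , gh<xy = eventually₂ (M , g<x) (N , h<y) λ n g<x h<y →
          subst (ℚ._< seq x n ℚ.+ seq y n)
            (trans (cong₂ ℚ._+_ (ℚ.+-identityˡ g) (ℚ.+-identityˡ h)) (sym (ℚ.+-identityˡ (g ℚ.+ h))))
            (ℚ.+-mono-< g<x h<y)
    in mk< (g ℚ.+ h) (ℚ.+-mono-< 0<g 0<h) K gh<xy

0≤+ : ∀ {x y} → 0ℝ ≤ x → 0ℝ ≤ y → 0ℝ ≤ x + y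
0≤+ {x} {y} 0≤x 0≤y = ≮0⇒0≤ λ 0<-[x+y] →
  [ 0≤⇒≮0 0≤x , 0≤⇒≮0 0≤y ]′ (0<+⇒0<⊎0< (0<-resp-≈ (≈-sym (-‿+-comm x y)) 0<-[x+y]))

0<-≤-+ : ∀ {x y} → 0ℝ < x → 0ℝ ≤ y → 0ℝ < x + y
0<-≤-+ {x} {y} 0<x 0≤y =
  [ (λ 0<x+y → 0<x+y) , (λ 0<-y → contradiction 0<-y (0≤⇒≮0 0≤y)) ]′
    (0<+⇒0<⊎0< (0<-resp-≈ (≈-sym (//-rightDividesʳ y x)) 0<x))

0≤∧≯0⇒≈0 : ∀ {x} → 0ℝ ≤ x → ¬ 0ℝ < x → x ≈ 0ℝ
0≤∧≯0⇒≈0 0≤x x≯0 = ¬≷⇒≈0 x≯0 (0≤⇒≮0 0≤x)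

-‿*-≈0 : ∀ {x y} → x * y ≈ 0ℝ → x * - y ≈ 0ℝ
-‿*-≈0 {x} {y} xy≈0 = ≈-trans (≈-sym (-‿distribʳ-* x y)) (≈-trans (-‿cong xy≈0) -0#≈0#)

*-cancel-0< : ∀ {x y} → 0ℝ < x → x * y ≈ 0ℝ → y ≈ 0ℝ
*-cancel-0< 0<x xy≈0 = ¬≷⇒≈0
  (λ 0<y → <-irrefl (≈-sym xy≈0) (0<* 0<x 0<y))
  (λ 0<-y → <-irrefl (≈-sym (-‿*-≈0 xy≈0)) (0<* 0<x 0<-y))

x*0≈0 : ∀ {x y} → y ≈ 0ℝ → x * y ≈ 0ℝ
x*0≈0 {x} y≈0 = ≈-trans (*-cong ≈-refl y≈0) (zeroʳ x)

0*x≈0 : ∀ {x y} → x ≈ 0ℝ → x * y ≈ 0ℝ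
0*x≈0 {y = y} x≈0 = ≈-trans (*-cong x≈0 ≈-refl) (zeroˡ y)

-- The goal is a negation, so each factor may be taken to be positive or zero, although this cannot
-- be decided: both positive contradicts a negative product, and a zero factor makes the product
-- zero.
0≤* : ∀ {x y} → 0ℝ ≤ x → 0ℝ ≤ y → 0ℝ ≤ x * y
0≤* {x} {y} 0≤x 0≤y = ≮0⇒0≤ λ 0<-xy → <-irrefl ≈-refl
  (0<-resp-≈ (≈-trans (-‿cong (0*x≈0 (0≤∧≯0⇒≈0 0≤x λ 0<x →
    <-irrefl ≈-refl (0<-resp-≈ (≈-trans (-‿cong (x*0≈0 (0≤∧≯0⇒≈0 0≤y λ 0<y →
      0≤⇒≮0 (<⇒0≤ (0<* 0<x 0<y)) 0<-xy))) -0#≈0#) 0<-xy)))) -0#≈0#) 0<-xy)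

-- Sums

sum-neg : ∀ {m} (t : Vector ℝ m) → sum (λ k → - t k) ≈ - sum t
sum-neg {zero}  t = ≈-sym -0#≈0#
sum-neg {suc m} t = ≈-trans (+-cong ≈-refl (sum-neg (t ∘ suc))) (-‿+-comm _ _)

sum-zero : ∀ {m} {t : Vector ℝ m} → (∀ k → t k ≈ 0ℝ) → sum t ≈ 0ℝ
sum-zero {m} t≈0 = ≈-trans (sum-cong-≋ t≈0) (sum-replicate-zero m)

sum-single : ∀ {m} {t : Vector ℝ m} l → (∀ k → k ≢ l → t k ≈ 0ℝ) → sum t ≈ t l
sum-single zero    t≈0 = ≈-trans (+-cong ≈-refl (sum-zero λ k → t≈0 (suc k) λ ())) (+-identityʳ _)
sum-single (suc l) t≈0 = ≈-trans
  (+-cong (t≈0 zero λ ()) (sum-single l λ k k≢l → t≈0 (suc k) (k≢l ∘ Fin.suc-injective)))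
  (+-identityˡ _)

0≤sum : ∀ {m} {t : Vector ℝ m} → (∀ k → 0ℝ ≤ t k) → 0ℝ ≤ sum t
0≤sum {zero}  0≤t = x≮x
0≤sum {suc m} 0≤t = 0≤+ (0≤t zero) (0≤sum (0≤t ∘ suc))

0<sum : ∀ {m} {t : Vector ℝ m} → (∀ k → 0ℝ ≤ t k) → ∀ l → 0ℝ < t l → 0ℝ < sum t
0<sum 0≤t zero    0<tₗ = 0<-≤-+ 0<tₗ (0≤sum (0≤t ∘ suc))
0<sum 0≤t (suc l) 0<tₗ = 0<-resp-≈ (+-comm _ _) (0<-≤-+ (0<sum (0≤t ∘ suc) l 0<tₗ) (0≤t zero))

sum≈0⇒≈0 : ∀ {m} {t : Vector ℝ m} → (∀ k → 0ℝ ≤ t k) → sum t ≈ 0ℝ → ∀ k → t k ≈ 0ℝ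
sum≈0⇒≈0 0≤t ∑t≈0 k = 0≤∧≯0⇒≈0 (0≤t k) λ 0<tₖ → <-irrefl (≈-sym ∑t≈0) (0<sum 0≤t k 0<tₖ)

0<sum⇒∃0< : ∀ {m} {t : Vector ℝ m} → 0ℝ < sum t → ∃[ k ] (0ℝ < t k)
0<sum⇒∃0< {zero}  0<0 = contradiction 0<0 x≮x
0<sum⇒∃0< {suc m} 0<∑ with 0<+⇒0<⊎0< 0<∑
... | inj₁ 0<t₀ = zero , 0<t₀
... | inj₂ 0<∑′ = let k , 0<tₖ = 0<sum⇒∃0< 0<∑′ in suc k , 0<tₖ

-- Affine functionals

module _ {n : ℕ} where

  ≋-refl : {x : Point n} → x ≋ x
  ≋-refl _ = ≈-refl

  ≋-sym : {x y : Point n} → x ≋ y → y ≋ x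
  ≋-sym x≋y j = ≈-sym (x≋y j)

  ≋-trans : {x y z : Point n} → x ≋ y → y ≋ z → x ≋ z
  ≋-trans x≋y y≋z j = ≈-trans (x≋y j) (y≋z j)

  slack : Point n → ℝ → Point n → ℝ
  slack c b x = b - c · x

  slack-cong : ∀ c b {x y} → x ≋ y → slack c b x ≈ slack c b y
  slack-cong c b x≋y = +-cong ≈-refl (-‿cong (sum-cong-≋ λ j → *-cong (≈-refl {c j}) (x≋y j)))

  ·-combination : ∀ {m} c (w : Vector ℝ m) (p : Vector (Point n) m) →
    c · combination w p ≈ sum λ k → w k * (c · p k)
  ·-combination c w p = begin
    (sum λ j → c j * sum λ k → w k * p k j)    ≈⟨ (sum-cong-≋ λ j → *-distribˡ-sum (c j) λ k → w k * p k j) ⟩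
    (sum λ j → sum λ k → c j * (w k * p k j))  ≈⟨ ∑-comm (λ j k → c j * (w k * p k j)) ⟩
    (sum λ k → sum λ j → c j * (w k * p k j))  ≈⟨ (sum-cong-≋ λ k → sum-cong-≋ λ j → swap (c j) (w k) (p k j)) ⟩
    (sum λ k → sum λ j → w k * (c j * p k j))  ≈⟨ (sum-cong-≋ λ k → *-distribˡ-sum (w k) λ j → c j * p k j) ⟨
    (sum λ k → w k * (c · p k))                ∎
    where
    open ≈-Reasoning
    ℚ-swap : ∀ p q r → p ℚ.* (q ℚ.* r) ≡ q ℚ.* (p ℚ.* r)
    ℚ-swap = solve-∀ ℚ-ring
    swap : ∀ x y z → x * (y * z) ≈ y * (x * z)
    swap x y z = ≗⇒≈ λ n → ℚ-swap (seq x n) (seq y n) (seq z n)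

  -- The sum of the weights is left open so that one identity covers both uses: total 1 gives
  -- `slack-affine`, total 0 gives `slack-dependency`.
  sum-slack : ∀ {m} c b (w : Vector ℝ m) (p : Vector (Point n) m) →
    (sum λ k → w k * slack c b (p k)) ≈ sum w * b - c · combination w p
  sum-slack c b w p = begin
    (sum λ k → w k * (b - c · p k))
      ≈⟨ (sum-cong-≋ λ k → x[y-z]≈xy-xz (w k) b (c · p k)) ⟩
    (sum λ k → w k * b + - (w k * (c · p k)))
      ≈⟨ ∑-distrib-+ (λ k → w k * b) (λ k → - (w k * (c · p k))) ⟩
    (sum λ k → w k * b) + (sum λ k → - (w k * (c · p k)))
      ≈⟨ +-cong (*-distribʳ-sum b w) (≈-sym (sum-neg λ k → w k * (c · p k))) ⟨
    sum w * b - (sum λ k → w k * (c · p k))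
      ≈⟨ +-cong ≈-refl (-‿cong (·-combination c w p)) ⟨
    sum w * b - c · combination w p
      ∎
    where open ≈-Reasoning

  slack-affine : ∀ {m} c b (w : Vector ℝ m) (p : Vector (Point n) m) {x} →
    sum w ≈ 1ℝ → x ≋ combination w p → slack c b x ≈ sum λ k → w k * slack c b (p k)
  slack-affine c b w p {x} ∑w≈1 x≋ = ≈-trans
    (+-cong (≈-trans (≈-sym (*-identityˡ b)) (*-cong (≈-sym ∑w≈1) ≈-refl))
            (-‿cong (sum-cong-≋ λ j → *-cong (≈-refl {c j}) (x≋ j))))
    (≈-sym (sum-slack c b w p))

  slack-dependency : ∀ {m} c b (w : Vector ℝ m) (p : Vector (Point n) m) →
    sum w ≈ 0ℝ → combination w p ≋ (λ _ → 0ℝ) → (sum λ k → w k * slack c b (p k)) ≈ 0ℝ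
  slack-dependency c b w p ∑w≈0 comb≈0 = ≈-trans (sum-slack c b w p) (≈-trans
    (+-cong (0*x≈0 ∑w≈0) (≈-trans (-‿cong (sum-zero λ j → x*0≈0 (comb≈0 j))) -0#≈0#))
    (+-identityˡ 0ℝ))

  -- Evaluating the `l`-th functional on a dependency leaves only the `l`-th term, with a positive
  -- factor that can be cancelled.
  dual⇒independent : ∀ {m} (p : Vector (Point n) m) →
    (∀ l → ∃[ c ] ∃[ b ] ((∀ k → k ≢ l → slack c b (p k) ≈ 0ℝ) × 0ℝ < slack c b (p l))) →
    AffinelyIndependent p
  dual⇒independent p dual w ∑w≈0 comb≈0 l =
    let c , b , vanish , 0<slack = dual l
    in *-cancel-0< 0<slack (≈-trans (*-comm _ (w l)) (≈-trans
         (≈-sym (sum-single l λ k k≢l → x*0≈0 (vanish k k≢l)))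
         (slack-dependency c b w p ∑w≈0 comb≈0)))

  Aff-combination : ∀ {m r} (w : Vector ℝ m) (p : Vector (Point n) m) {q : Vector (Point n) r} {x} →
    (∀ k → p k ∈ Aff q) → sum w ≈ 1ℝ → x ≋ combination w p → x ∈ Aff q
  Aff-combination w p {q} {x} p∈ ∑w≈1 x≋ = v , ∑v≈1 , λ j → ≈-trans (x≋ j) (expand j)
    where
    open ≈-Reasoning
    u = λ k → proj₁ (p∈ k)
    v = λ i → sum λ k → w k * u k i
    ∑v≈1 = begin
      sum v                                ≈⟨ ∑-comm (λ i k → w k * u k i) ⟩
      (sum λ k → sum λ i → w k * u k i)    ≈⟨ (sum-cong-≋ λ k → *-distribˡ-sum (w k) (u k)) ⟨
      (sum λ k → w k * sum (u k))          ≈⟨ (sum-cong-≋ λ k → ≈-trans (*-cong ≈-refl (proj₁ (proj₂ (p∈ k)))) (*-comm (w k) 1ℝ)) ⟩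
      (sum λ k → 1ℝ * w k)                 ≈⟨ (sum-cong-≋ λ k → *-identityˡ (w k)) ⟩
      sum w                                ≈⟨ ∑w≈1 ⟩
      1ℝ                                   ∎
    expand : ∀ j → combination w p j ≈ combination v q j
    expand j = begin
      (sum λ k → w k * p k j)
        ≈⟨ (sum-cong-≋ λ k → *-cong ≈-refl (proj₂ (proj₂ (p∈ k)) j)) ⟩
      (sum λ k → w k * sum λ i → u k i * q i j)
        ≈⟨ (sum-cong-≋ λ k → *-distribˡ-sum (w k) λ i → u k i * q i j) ⟩
      (sum λ k → sum λ i → w k * (u k i * q i j))
        ≈⟨ ∑-comm (λ k i → w k * (u k i * q i j)) ⟩
      (sum λ i → sum λ k → w k * (u k i * q i j))
        ≈⟨ (sum-cong-≋ λ i → sum-cong-≋ λ k → *-assoc (w k) (u k i) (q i j)) ⟨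
      (sum λ i → sum λ k → w k * u k i * q i j)
        ≈⟨ (sum-cong-≋ λ i → *-distribʳ-sum (q i j) λ k → w k * u k i) ⟨
      (sum λ i → v i * q i j)
        ∎

-- Integers as real numbers

ιℚ : ℤ → ℚ
ιℚ a = ℚ.fromℚᵘ (ℚᵘ.mkℚᵘ a 0)

ι : ℤ → ℝ
ι a = fromℚ (ιℚ a)

ι-+ : ∀ a b → ι (a ℤ.+ b) ≈ ι a + ι b
ι-+ a b = ≗⇒≈ λ _ → ℚ.toℚᵘ-injective (begin
  ℚ.toℚᵘ (ιℚ (a ℤ.+ b))                 ≈⟨ ℚ.toℚᵘ-fromℚᵘ _ ⟩
  ℚᵘ.mkℚᵘ (a ℤ.+ b) 0                   ≡⟨ cong (λ c → ℚᵘ.mkℚᵘ c 0) (cong₂ ℤ._+_ (ℤ.*-identityʳ a) (ℤ.*-identityʳ b)) ⟨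
  ℚᵘ.mkℚᵘ a 0 ℚᵘ.+ ℚᵘ.mkℚᵘ b 0          ≈⟨ ℚᵘ.+-cong (ℚ.toℚᵘ-fromℚᵘ (ℚᵘ.mkℚᵘ a 0)) (ℚ.toℚᵘ-fromℚᵘ (ℚᵘ.mkℚᵘ b 0)) ⟨
  ℚ.toℚᵘ (ιℚ a) ℚᵘ.+ ℚ.toℚᵘ (ιℚ b)      ≈⟨ ℚ.toℚᵘ-homo-+ (ιℚ a) (ιℚ b) ⟨
  ℚ.toℚᵘ (ιℚ a ℚ.+ ιℚ b)                ∎)
  where open SetoidReasoning ℚᵘ.≃-setoid

ι-* : ∀ a b → ι (a ℤ.* b) ≈ ι a * ι b
ι-* a b = ≗⇒≈ λ _ → ℚ.toℚᵘ-injective (begin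
  ℚ.toℚᵘ (ιℚ (a ℤ.* b))                 ≈⟨ ℚ.toℚᵘ-fromℚᵘ _ ⟩
  ℚᵘ.mkℚᵘ a 0 ℚᵘ.* ℚᵘ.mkℚᵘ b 0          ≈⟨ ℚᵘ.*-cong (ℚ.toℚᵘ-fromℚᵘ (ℚᵘ.mkℚᵘ a 0)) (ℚ.toℚᵘ-fromℚᵘ (ℚᵘ.mkℚᵘ b 0)) ⟨
  ℚ.toℚᵘ (ιℚ a) ℚᵘ.* ℚ.toℚᵘ (ιℚ b)      ≈⟨ ℚ.toℚᵘ-homo-* (ιℚ a) (ιℚ b) ⟨
  ℚ.toℚᵘ (ιℚ a ℚ.* ιℚ b)                ∎)
  where open SetoidReasoning ℚᵘ.≃-setoid

ι-neg : ∀ a → ι (ℤ.- a) ≈ - ι a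
ι-neg (+ zero)  = ≗⇒≈ λ _ → refl
ι-neg (+ suc n) = ≗⇒≈ λ _ → refl
ι-neg -[1+ n ]  = ≗⇒≈ λ _ → neg-involutive (ιℚ (+ suc n))
  where
  neg-involutive : ∀ q → q ≡ ℚ.- ℚ.- q
  neg-involutive = solve-∀ ℚ-ring

0<ι : ∀ {a} → ℤ.0ℤ ℤ.< a → 0ℝ < ι a
0<ι {+ suc n} _ = mk< (½ ℚ.* q) (0<½* 0<q) 0 λ _ _ → begin-strict
  0ℚ ℚ.+ ½ ℚ.* q           <⟨ ℚ.+-monoˡ-< (½ ℚ.* q) (0<½* 0<q) ⟩
  ½ ℚ.* q ℚ.+ ½ ℚ.* q      ≡⟨ ½*ε+½*ε≡ε q ⟩
  q                        ∎
  where
  open ℚ.≤-Reasoning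
  q = ιℚ (+ suc n)
  0<q : 0ℚ ℚ.< q
  0<q = ℚ.positive⁻¹ q {{ℚ.normalize-pos (suc n) 1}}
0<ι {+ zero} (ℤ.+<+ ())

0≤ι : ∀ {a} → ℤ.0ℤ ℤ.≤ a → 0ℝ ≤ ι a
0≤ι {+ zero}  _ = x≮x
0≤ι {+ suc n} _ = <⇒0≤ (0<ι {+ suc n} (ℤ.+<+ (ℕ.s≤s ℕ.z≤n)))

-- Faces

≤⇒0≤- : ∀ {x y} → x ≤ y → 0ℝ ≤ y - x
≤⇒0≤- x≤y = ≮0⇒0≤ λ 0<-[y-x] → x≤y (0<-⇒< (0<-resp-≈ (⁻¹-anti-homo-// _ _) 0<-[y-x]))

0≤-⇒≤ : ∀ {x y} → 0ℝ ≤ y - x → x ≤ y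
0≤-⇒≤ 0≤y-x y<x = 0≤⇒≮0 0≤y-x (0<-resp-≈ (≈-sym (⁻¹-anti-homo-// _ _)) (<⇒0<- y<x))

module _ {n} {P : Subset n} where

  slackOf : Face P → Point n → ℝ
  slackOf F = slack (normal F) (offset F)

  0≤slack : ∀ F {x} → x ∈ P → 0ℝ ≤ slackOf F x
  0≤slack F x∈P = ≤⇒0≤- (valid F x∈P)

  slack≈0 : ∀ F {x} → x ∈ points F → slackOf F x ≈ 0ℝ
  slack≈0 F (_ , c·x≈b) = x≈y⇒x∙y⁻¹≈ε (≈-sym c·x≈b)

  ∈points : ∀ F {x} → x ∈ P → slackOf F x ≈ 0ℝ → x ∈ points F
  ∈points F x∈P slack≈0 = x∈P , ≈-sym (x∙y⁻¹≈ε⇒x≈y _ _ slack≈0)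

  ∈points-resp-≋ : ∀ F {x y} → x ≋ y → y ∈ P → x ∈ points F → y ∈ points F
  ∈points-resp-≋ F x≋y y∈P x∈F = ∈points F y∈P
    (≈-trans (slack-cong (normal F) (offset F) (≋-sym x≋y)) (slack≈0 F x∈F))

  face : ∀ c b → (∀ {x} → x ∈ P → 0ℝ ≤ slack c b x) → Face P
  face c b 0≤slack = record { normal = c ; offset = b ; valid = λ x∈P → 0≤-⇒≤ (0≤slack x∈P) }

  -- Negative coefficients are allowed only at points of F, where the slack is 0. Hence all terms of
  -- the vanishing sum of `α k * slackOf F (x k)` are nonnegative, so all are 0, and a positive
  -- `α l` forces slack 0 at `x l`.
  dependency-face : ∀ (F : Face P) {m} (α : Vector ℝ m) (x : Vector (Point n) m) →
    sum α ≈ 0ℝ → combination α x ≋ (λ _ → 0ℝ) →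
    (∀ k → α k ≈ 0ℝ ⊎ (0ℝ ≤ α k × x k ∈ P) ⊎ x k ∈ points F) →
    ∀ l → 0ℝ < α l → x l ∈ P → x l ∈ points F
  dependency-face F α x ∑α≈0 comb≈0 cases l 0<αₗ xₗ∈P = ∈points F xₗ∈P (*-cancel-0< 0<αₗ
    (sum≈0⇒≈0 {t = λ k → α k * slackOf F (x k)} nonneg
      (slack-dependency (normal F) (offset F) α x ∑α≈0 comb≈0) l))
    where
    nonneg : ∀ k → 0ℝ ≤ α k * slackOf F (x k)
    nonneg k with cases k
    ... | inj₁ αₖ≈0                = ≈⇒0≤ (0*x≈0 αₖ≈0)
    ... | inj₂ (inj₁ (0≤αₖ , xₖ∈P)) = 0≤* 0≤αₖ (0≤slack F xₖ∈P)
    ... | inj₂ (inj₂ xₖ∈F)         = ≈⇒0≤ (x*0≈0 (slack≈0 F xₖ∈F))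

-- Convex hulls

indicator : ∀ {m} → Fin m → Vector ℝ m
indicator i k with k Fin.≟ i
... | yes _ = 1ℝ
... | no _  = 0ℝ

indicator-at : ∀ {m} (i : Fin m) → indicator i i ≈ 1ℝ
indicator-at i with i Fin.≟ i
... | yes _  = ≈-refl
... | no i≢i = contradiction refl i≢i

indicator-off : ∀ {m} (i k : Fin m) → k ≢ i → indicator i k ≈ 0ℝ
indicator-off i k k≢i with k Fin.≟ i
... | yes k≡i = contradiction k≡i k≢i
... | no _    = ≈-refl

0≤indicator : ∀ {m} (i k : Fin m) → 0ℝ ≤ indicator i k
0≤indicator i k with k Fin.≟ i
... | yes _ = <⇒0≤ 0<1
... | no _  = x≮x

sum-indicator : ∀ {m} (i : Fin m) → sum (indicator i) ≈ 1ℝ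
sum-indicator i = ≈-trans (sum-single i (indicator-off i)) (indicator-at i)

combination-indicator : ∀ {n m} (p : Vector (Point n) m) i → p i ≋ combination (indicator i) p
combination-indicator p i j = ≈-sym (≈-trans
  (sum-single i λ k k≢i → 0*x≈0 (indicator-off i k k≢i))
  (≈-trans (*-cong (indicator-at i) ≈-refl) (*-identityˡ (p i j))))

∈Aff : ∀ {n m} (p : Vector (Point n) m) i → p i ∈ Aff p
∈Aff p i = indicator i , sum-indicator i , combination-indicator p i

Aff-single : ∀ {n} (q : Vector (Point n) 1) {x} → x ∈ Aff q → x ≋ q zero
Aff-single q (w , ∑w≈1 , x≋) j = ≈-trans (x≋ j) (≈-trans (+-identityʳ _)
  (≈-trans (*-cong (≈-trans (≈-sym (+-identityʳ _)) ∑w≈1) ≈-refl) (*-identityˡ (q zero j))))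

module _ {n m} (p : Vector (Point n) m) where

  ∈Conv : ∀ i → p i ∈ Conv p
  ∈Conv i = indicator i , 0≤indicator i , sum-indicator i , combination-indicator p i

  Conv-0≤slack : ∀ c b → (∀ k → 0ℝ ≤ slack c b (p k)) → ∀ {x} → x ∈ Conv p → 0ℝ ≤ slack c b x
  Conv-0≤slack c b 0≤slack (w , 0≤w , ∑w≈1 , x≋) = 0≤-resp-≈
    (≈-sym (slack-affine c b w p ∑w≈1 x≋)) (0≤sum λ k → 0≤* (0≤w k) (0≤slack k))

  -- Complementary slackness. The conclusion stays a product because it cannot be decided which
  -- factor vanishes.
  face-weights : ∀ (F : Face (Conv p)) {x} (x∈F : x ∈ points F) →
    let w = proj₁ (proj₁ x∈F) in ∀ k → w k * slackOf F (p k) ≈ 0ℝ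
  face-weights F x∈F@((w , 0≤w , ∑w≈1 , x≋) , _) = sum≈0⇒≈0
    (λ k → 0≤* (0≤w k) (0≤slack F (∈Conv k)))
    (≈-trans (≈-sym (slack-affine (normal F) (offset F) w p ∑w≈1 x≋)) (slack≈0 F x∈F))

  -- The weights have the positive sum 1, so an index with positive weight can be extracted, and
  -- there the slack is 0.
  face-meets-vertices : ∀ (F : Face (Conv p)) {x} → x ∈ points F → ∃[ i ] (p i ∈ points F)
  face-meets-vertices F x∈F@((w , 0≤w , ∑w≈1 , x≋) , _) =
    let i , 0<wᵢ = 0<sum⇒∃0< (0<-resp-≈ (≈-sym ∑w≈1) 0<1)
    in i , ∈points F (∈Conv i) (*-cancel-0< 0<wᵢ (face-weights F x∈F i))

  face⊆Aff : ∀ (F : Face (Conv p)) {r} {q : Vector (Point n) (suc r)} →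
    (∀ k → 0ℝ < slackOf F (p k) ⊎ p k ∈ Aff q) → points F ⊆ Aff q
  face⊆Aff F {r} {q} cases {x} x∈F@((w , 0≤w , ∑w≈1 , x≋) , _) =
    Aff-combination w (λ k → proj₁ (replace k)) {q} {x} (λ k → proj₁ (proj₂ (replace k))) ∑w≈1
      λ j → ≈-trans (x≋ j) (sum-cong-≋ λ k → proj₂ (proj₂ (replace k)) j)
    where
    -- A vertex off F has weight 0, so it can be replaced by any point of Aff q.
    replace : ∀ k → Σ (Point n) λ y → (y ∈ Aff q × (∀ j → w k * p k j ≈ w k * y j))
    replace k with cases k
    ... | inj₂ pₖ∈    = p k , pₖ∈ , λ j → ≈-refl
    ... | inj₁ 0<slack = q zero , ∈Aff-zero , λ j → ≈-trans (0*x≈0 wₖ≈0) (≈-sym (0*x≈0 wₖ≈0))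
      where
      wₖ≈0 = *-cancel-0< 0<slack (≈-trans (*-comm _ (w k)) (face-weights F x∈F k))
      ∈Aff-zero : q zero ∈ Aff q
      ∈Aff-zero = ∈Aff q zero

-- Graphs of polytopes with labelled vertices

-- What has to be known about a polytope to identify its graph with the abstract graph `E`. Both P
-- and the 5-cube receive a labelling by the same `E`, which makes their graphs isomorphic.
record Labelling {n m} (P : Subset n) (E : Rel (Fin m) 0ℓ) : Set where
  field
    pt       : Vector (Point n) m
    pt∈      : ∀ i → pt i ∈ P
    tip      : Fin m → Face P
    pt∈tip   : ∀ i → pt i ∈ points (tip i)
    tip-off  : ∀ i j → j ≢ i → 0ℝ < slackOf (tip i) (pt j)
    tip-≋    : ∀ i {x} → x ∈ points (tip i) → x ≋ pt i
    covering : ∀ (F : Face P) {x} → x ∈ points F → ∃[ i ] (pt i ∈ points F)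
    edge     : ∀ {i j} → E i j → Σ (Face P) λ F →
      pt i ∈ points F × pt j ∈ points F × points F ⊆ Aff (pt i ∷ pt j ∷ [])
    -- by not-collinear below, such a face is not an edge
    third    : ∀ {i j} → i ≢ j → ¬ E i j → ∃[ l ] (l ≢ i × l ≢ j ×
      (∀ F → pt i ∈ points F → pt j ∈ points F → pt l ∈ points F))

  pt-injective : ∀ {i j} → pt i ≋ pt j → i ≡ j
  pt-injective {i} {j} ptᵢ≋ptⱼ with j Fin.≟ i
  ... | yes j≡i = sym j≡i
  ... | no j≢i  = contradiction (tip-off i j j≢i) (<-irrefl (≈-sym
    (≈-trans (slack-cong (normal (tip i)) (offset (tip i)) (≋-sym ptᵢ≋ptⱼ)) (slack≈0 (tip i) (pt∈tip i)))))

  -- If a combination with coefficients u, v, w of three vertices vanishes,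
  -- the face at each of them shows that the other two coefficients have
  -- opposite signs, which is impossible for all three pairs.
  not-collinear : ∀ {s : Vector (Point n) 2} {i j l} → i ≢ j → i ≢ l → j ≢ l →
    pt i ∈ Aff s → pt j ∈ Aff s → ¬ pt l ∈ Aff s
  not-collinear {s} {i} {j} {l} i≢j i≢l j≢l ptᵢ∈ ptⱼ∈ ptₗ∈ =
    <-irrefl (≈-sym (≈-trans (same-parameter (tip i)) (slack≈0 (tip i) (pt∈tip i)))) (tip-off i l (i≢l ∘ sym))
    where
    param : ∀ {k} → pt k ∈ Aff s → ℝ
    param (t , _) = t (suc zero)
    tᵢ = param ptᵢ∈
    tⱼ = param ptⱼ∈
    tₗ = param ptₗ∈
    u = tⱼ - tₗ
    v = tₗ - tᵢ
    w = tᵢ - tⱼ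
    σ₀ σ₁ : Face P → ℝ
    σ₀ F = slackOf F (s zero)
    σ₁ F = slackOf F (s (suc zero))

    at : ∀ F {k} (ptₖ∈ : pt k ∈ Aff s) → slackOf F (pt k) ≈ σ₀ F + param ptₖ∈ * (σ₁ F - σ₀ F)
    at F (t , ∑t≈1 , pt≋) = ≈-trans (slack-affine (normal F) (offset F) t s ∑t≈1 pt≋) (≈-trans
      (≗⇒≈ λ n → regroup (seq (t zero) n) (seq (t (suc zero)) n) (seq (σ₀ F) n) (seq (σ₁ F) n))
      (+-cong (≈-trans (*-cong ∑t≈1 ≈-refl) (*-identityˡ (σ₀ F))) ≈-refl))
      where
      regroup : ∀ a b x y → a ℚ.* x ℚ.+ (b ℚ.* y ℚ.+ 0ℚ) ≡
        (a ℚ.+ (b ℚ.+ 0ℚ)) ℚ.* x ℚ.+ b ℚ.* (y ℚ.+ ℚ.- x)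
      regroup = solve-∀ ℚ-ring

    dependent : ∀ F → u * slackOf F (pt i) + (v * slackOf F (pt j) + w * slackOf F (pt l)) ≈ 0ℝ
    dependent F = ≈-trans
      (+-cong (*-cong ≈-refl (at F ptᵢ∈)) (+-cong (*-cong ≈-refl (at F ptⱼ∈)) (*-cong ≈-refl (at F ptₗ∈))))
      (≗⇒≈ λ n → vanish (seq tᵢ n) (seq tⱼ n) (seq tₗ n) (seq (σ₀ F) n) (seq (σ₁ F - σ₀ F) n))
      where
      vanish : ∀ a b c x y →
        (b ℚ.+ ℚ.- c) ℚ.* (x ℚ.+ a ℚ.* y) ℚ.+
        ((c ℚ.+ ℚ.- a) ℚ.* (x ℚ.+ b ℚ.* y) ℚ.+ (a ℚ.+ ℚ.- b) ℚ.* (x ℚ.+ c ℚ.* y)) ≡ 0ℚ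
      vanish = solve-∀ ℚ-ring

    -- If `- y` were not positive, y would be nonnegative and the sum positive. The double negation
    -- suffices, since the chains below end in a contradiction.
    opposite-signs : ∀ {x y g h} → 0ℝ < g → 0ℝ < h → x * g + y * h ≈ 0ℝ → 0ℝ < x → ¬ ¬ (0ℝ < - y)
    opposite-signs 0<g 0<h eq 0<x y≮0 =
      <-irrefl (≈-sym eq) (0<-≤-+ (0<* 0<x 0<g) (0≤* (≮0⇒0≤ y≮0) (<⇒0≤ 0<h)))

    negated : ∀ {x y g h} → x * g + y * h ≈ 0ℝ → - x * g + - y * h ≈ 0ℝ
    negated {x} {y} {g} {h} eq = ≈-trans
      (≈-trans (+-cong (≈-sym (-‿distribˡ-* x g)) (≈-sym (-‿distribˡ-* y h))) (-‿+-comm (x * g) (y * h)))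
      (≈-trans (-‿cong eq) -0#≈0#)

    flipped : ∀ {x y} → x + y ≈ 0ℝ → y + x ≈ 0ℝ
    flipped = ≈-trans (+-comm _ _)

    ij : u * slackOf (tip l) (pt i) + v * slackOf (tip l) (pt j) ≈ 0ℝ
    ij = ≈-trans (+-cong ≈-refl (≈-sym (≈-trans (+-cong ≈-refl (x*0≈0 (slack≈0 (tip l) (pt∈tip l)))) (+-identityʳ _))))
           (dependent (tip l))
    il : u * slackOf (tip j) (pt i) + w * slackOf (tip j) (pt l) ≈ 0ℝ
    il = ≈-trans (+-cong ≈-refl (≈-sym (≈-trans (+-cong (x*0≈0 (slack≈0 (tip j) (pt∈tip j))) ≈-refl) (+-identityˡ _))))
           (dependent (tip j))
    jl : v * slackOf (tip i) (pt j) + w * slackOf (tip i) (pt l) ≈ 0ℝ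
    jl = ≈-trans (≈-sym (≈-trans (+-cong (x*0≈0 (slack≈0 (tip i) (pt∈tip i))) ≈-refl) (+-identityˡ _)))
           (dependent (tip i))

    v≯0 : ¬ 0ℝ < v
    v≯0 0<v =
      opposite-signs (tip-off i j (i≢j ∘ sym)) (tip-off i l (i≢l ∘ sym)) jl 0<v λ 0<-w →
      opposite-signs (tip-off j l (j≢l ∘ sym)) (tip-off j i i≢j) (flipped (negated il)) 0<-w λ 0<--u →
      opposite-signs (tip-off l i i≢l) (tip-off l j j≢l) ij (0<-resp-≈ (-‿involutive u) 0<--u) λ 0<-v →
      0≤⇒≮0 (<⇒0≤ 0<v) 0<-v
    v≮0 : ¬ 0ℝ < - v
    v≮0 0<-v =
      opposite-signs (tip-off i j (i≢j ∘ sym)) (tip-off i l (i≢l ∘ sym)) (negated jl) 0<-v λ 0<--w →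
      opposite-signs (tip-off j l (j≢l ∘ sym)) (tip-off j i i≢j) (flipped il) (0<-resp-≈ (-‿involutive w) 0<--w) λ 0<-u →
      opposite-signs (tip-off l i i≢l) (tip-off l j j≢l) (negated ij) 0<-u λ 0<--v →
      0≤⇒≮0 (<⇒0≤ 0<-v) 0<--v

    same-parameter : ∀ F → slackOf F (pt l) ≈ slackOf F (pt i)
    same-parameter F = ≈-trans (at F ptₗ∈) (≈-trans
      (+-cong ≈-refl (*-cong (x∙y⁻¹≈ε⇒x≈y _ _ (¬≷⇒≈0 v≯0 v≮0)) ≈-refl)) (≈-sym (at F ptᵢ∈)))

  tip-dimension : ∀ i → HasDimension (points (tip i)) 0
  tip-dimension i = (λ _ → pt i) , (λ _ → pt∈tip i)
    , (λ { w ∑w≈0 _ zero → ≈-trans (≈-sym (+-identityʳ _)) ∑w≈0 })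
    , λ x∈tip → (λ _ → 1ℝ) , +-identityʳ 1ℝ
              , λ j → ≈-trans (tip-≋ i x∈tip j) (≈-sym (≈-trans (+-identityʳ _) (*-identityˡ _)))

  independent : ∀ i j → i ≢ j → AffinelyIndependent (pt i ∷ pt j ∷ [])
  independent i j i≢j = dual⇒independent (pt i ∷ pt j ∷ []) dual
    where
    dual : ∀ l → ∃[ c ] ∃[ b ] ((∀ k → k ≢ l → slack c b ((pt i ∷ pt j ∷ []) k) ≈ 0ℝ) ×
                                0ℝ < slack c b ((pt i ∷ pt j ∷ []) l))
    dual zero = normal (tip j) , offset (tip j)
      , (λ { zero 0≢0 → contradiction refl 0≢0 ; (suc zero) _ → slack≈0 (tip j) (pt∈tip j) })
      , tip-off j i i≢j
    dual (suc zero) = normal (tip i) , offset (tip i)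
      , (λ { zero _ → slack≈0 (tip i) (pt∈tip i) ; (suc zero) 1≢1 → contradiction refl 1≢1 })
      , tip-off i j (i≢j ∘ sym)

  vertex : Fin m → Vertex P
  vertex i = pt i , tip i , tip-dimension i , pt∈tip i

  label : Vertex P → Fin m
  label (_ , F , _ , x∈F) = proj₁ (covering F x∈F)

  -- The zero-dimensional face of the vertex lies in the affine hull of one point, so the labelled
  -- point that `covering` finds in it can only be the vertex.
  pt-label : ∀ v → proj₁ v ≋ pt (label v)
  pt-label (_ , F , (q , _ , _ , F⊆Aff) , x∈F) =
    ≋-trans (Aff-single q (F⊆Aff x∈F)) (≋-sym (Aff-single q (F⊆Aff (proj₂ (covering F x∈F)))))

  vertex∈ : ∀ v → proj₁ v ∈ P
  vertex∈ (_ , _ , _ , x∈P , _) = x∈P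

  label-cong : ∀ u v → SameVertex P u v → label u ≡ label v
  label-cong u v u≋v = pt-injective (≋-trans (≋-sym (pt-label u)) (≋-trans u≋v (pt-label v)))

  label-injective : ∀ u v → label u ≡ label v → SameVertex P u v
  label-injective u v eq = ≋-trans (pt-label u)
    (subst (λ i → pt i ≋ proj₁ v) (sym eq) (≋-sym (pt-label v)))

  label-vertex : ∀ i → label (vertex i) ≡ i
  label-vertex i = sym (pt-injective (pt-label (vertex i)))

  module _ (E? : Decidable E) (E-irrefl : Irreflexive _≡_ E) where

    adjacent⇒E : ∀ u v → Adjacent P u v → E (label u) (label v)
    adjacent⇒E u v (u≉v , F , (q , _ , _ , F⊆Aff) , u∈F , v∈F) with E? (label u) (label v)
    ... | yes e = e
    ... | no ¬e =
      let i≢j = λ eq → u≉v (label-injective u v eq)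
          l , l≢i , l≢j , through = third i≢j ¬e
          ptᵢ∈F = ∈points-resp-≋ F (pt-label u) (pt∈ (label u)) u∈F
          ptⱼ∈F = ∈points-resp-≋ F (pt-label v) (pt∈ (label v)) v∈F
      in contradiction (F⊆Aff (through F ptᵢ∈F ptⱼ∈F))
           (not-collinear {s = q} i≢j (l≢i ∘ sym) (l≢j ∘ sym) (F⊆Aff ptᵢ∈F) (F⊆Aff ptⱼ∈F))

    E⇒adjacent : ∀ u v → E (label u) (label v) → Adjacent P u v
    E⇒adjacent u v e =
      let F , ptᵢ∈F , ptⱼ∈F , F⊆Aff = edge e
          i≢j = λ i≡j → E-irrefl i≡j e
      in (λ u≋v → i≢j (label-cong u v u≋v)) , F
       , ( pt (label u) ∷ pt (label v) ∷ []
         , (λ { zero → ptᵢ∈F ; (suc zero) → ptⱼ∈F })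
         , independent (label u) (label v) i≢j
         , F⊆Aff)
       , ∈points-resp-≋ F (≋-sym (pt-label u)) (vertex∈ u) ptᵢ∈F
       , ∈points-resp-≋ F (≋-sym (pt-label v)) (vertex∈ v) ptⱼ∈F

labellings⇒isomorphic : ∀ {m n k} {P : Subset n} {Q : Subset k} {E : Rel (Fin m) 0ℓ} →
  Decidable E → Irreflexive _≡_ E → Labelling P E → Labelling Q E → GraphIsomorphic P Q
labellings⇒isomorphic {P = P} {Q} {E} E? E-irrefl ℓP ℓQ = f , record
  { isOrderMonomorphism = record
    { isOrderHomomorphism = record
      { cong = λ {u} {v} u≋v → same (label-cong ℓP u v u≋v)
      ; mono = λ {u} {v} adj → E⇒adjacent ℓQ E? E-irrefl (f u) (f v)
          (subst₂ E (sym (label-f u)) (sym (label-f v)) (adjacent⇒E ℓP E? E-irrefl u v adj)) }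
    ; injective = λ {u} {v} eq → label-injective ℓP u v (pt-injective ℓQ eq)
    ; cancel = λ {u} {v} adj → E⇒adjacent ℓP E? E-irrefl u v
        (subst₂ E (label-f u) (label-f v) (adjacent⇒E ℓQ E? E-irrefl (f u) (f v) adj)) }
  ; surjective = λ v → vertex ℓP (label ℓQ v) , λ {u} u≋ → ≋-trans
      (same (trans (label-cong ℓP u (vertex ℓP (label ℓQ v)) u≋) (label-vertex ℓP (label ℓQ v))))
      (≋-sym (pt-label ℓQ v)) }
  where
  open Labelling
  f : Vertex P → Vertex Q
  f u = vertex ℓQ (label ℓP u)
  label-f : ∀ u → label ℓQ (f u) ≡ label ℓP u
  label-f u = label-vertex ℓQ (label ℓP u)
  same : ∀ {i j} → i ≡ j → pt ℓQ i ≋ pt ℓQ j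
  same refl = ≋-refl

-- Faces of the cube

module _ {n} {P : Subset n} where

  slack-+ : ∀ (F : Face P) x y → slackOf F y + (sum λ i → normal F i * (y i - x i)) ≈ slackOf F x
  slack-+ F x y = begin
    (offset F - normal F · y) + (sum λ i → normal F i * (y i - x i))
      ≈⟨ +-cong ≈-refl (sum-cong-≋ λ i → x[y-z]≈xy-xz (normal F i) (y i) (x i)) ⟩
    (offset F - normal F · y) + (sum λ i → normal F i * y i + - (normal F i * x i))
      ≈⟨ +-cong ≈-refl (∑-distrib-+ (λ i → normal F i * y i) (λ i → - (normal F i * x i))) ⟩
    (offset F - normal F · y) + (normal F · y + (sum λ i → - (normal F i * x i)))
      ≈⟨ +-cong ≈-refl (+-cong ≈-refl (sum-neg λ i → normal F i * x i)) ⟩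
    (offset F - normal F · y) + (normal F · y - normal F · x)
      ≈⟨ telescope (offset F) (normal F · y) (normal F · x) ⟩
    offset F - normal F · x ∎
    where
    open ≈-Reasoning
    ℚ-telescope : ∀ p q r → (p ℚ.+ ℚ.- q) ℚ.+ (q ℚ.+ ℚ.- r) ≡ p ℚ.+ ℚ.- r
    ℚ-telescope = solve-∀ ℚ-ring
    telescope : ∀ x y z → (x - y) + (y - z) ≈ x - z
    telescope x y z = ≗⇒≈ λ n → ℚ-telescope (seq x n) (seq y n) (seq z n)

  -- From x to y the slack drops from 0 by a sum of nonnegative terms, while `y ∈ P` keeps it
  -- nonnegative.
  ascend : ∀ (F : Face P) {x y} → x ∈ points F → y ∈ P →
    (∀ i → 0ℝ ≤ normal F i * (y i - x i)) → y ∈ points F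
  ascend F {x} {y} x∈F y∈P 0≤ = ∈points F y∈P (0≤∧≯0⇒≈0 (0≤slack F y∈P) λ 0<slack →
    <-irrefl (≈-sym (≈-trans (slack-+ F x y) (slack≈0 F x∈F))) (0<-≤-+ 0<slack (0≤sum 0≤)))

digit : Fin 2 → ℝ
digit 0F = 0ℝ
digit 1F = 1ℝ

-- The distance of a point of the interval from the end `digit d`; it is the slack of the inequality
-- `outward d * x ≤ digit d`.
gap : Fin 2 → ℝ → ℝ
gap 0F x = x
gap 1F x = 1ℝ - x

outward : Fin 2 → ℝ
outward 0F = - 1ℝ
outward 1F = 1ℝ

InInterval : ℝ → Set
InInterval x = 0ℝ ≤ x × x ≤ 1ℝ

0≤gap : ∀ d {x} → InInterval x → 0ℝ ≤ gap d x
0≤gap 0F (0≤x , _) = 0≤x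
0≤gap 1F (_ , x≤1) = ≤⇒0≤- x≤1

digit∈ : ∀ d → InInterval (digit d)
digit∈ 0F = x≮x , λ 1<0 → <⇒0≤ 0<1 1<0
digit∈ 1F = <⇒0≤ 0<1 , x≮x

gap≈0⇒≈digit : ∀ d {x} → gap d x ≈ 0ℝ → x ≈ digit d
gap≈0⇒≈digit 0F x≈0   = x≈0
gap≈0⇒≈digit 1F 1-x≈0 = ≈-sym (x∙y⁻¹≈ε⇒x≈y _ _ 1-x≈0)

≈digit⇒gap≈0 : ∀ d {x} → x ≈ digit d → gap d x ≈ 0ℝ
≈digit⇒gap≈0 0F x≈0 = x≈0
≈digit⇒gap≈0 1F x≈1 = x≈y⇒x∙y⁻¹≈ε (≈-sym x≈1)

gap-digit : ∀ d e → d ≢ e → 0ℝ < gap d (digit e)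
gap-digit 0F 0F d≢e = contradiction refl d≢e
gap-digit 0F 1F _   = 0<1
gap-digit 1F 0F _   = 0<-resp-≈ (≗⇒≈ λ _ → refl) 0<1
gap-digit 1F 1F d≢e = contradiction refl d≢e

gap-affine : ∀ d x → digit d - outward d * x ≈ gap d x
gap-affine 0F x = ≗⇒≈ λ n → negate (seq x n)
  where
  negate : ∀ p → 0ℚ ℚ.+ ℚ.- (ℚ.- 1ℚ ℚ.* p) ≡ p
  negate = solve-∀ ℚ-ring
gap-affine 1F x = +-cong ≈-refl (-‿cong (*-identityˡ x))

module _ {k : ℕ} where

  corner : (Fin k → Fin 2) → Point k
  corner v i = digit (v i)

  corner∈ : ∀ v → corner v ∈ Cube k
  corner∈ v i = digit∈ (v i)

  module _ (v : Fin k → Fin 2) (S : Fin k → Bool) where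

    private
      gaps : Point k → Vector ℝ k
      gaps x i = if S i then gap (v i) (x i) else 0ℝ

      0≤gaps : ∀ {x} → x ∈ Cube k → ∀ i → 0ℝ ≤ gaps x i
      0≤gaps x∈ i with S i
      ... | true  = 0≤gap (v i) (x∈ i)
      ... | false = x≮x

      c : Point k
      c i = if S i then outward (v i) else 0ℝ

      b : ℝ
      b = sum λ i → if S i then digit (v i) else 0ℝ

      slack-gaps : ∀ x → slack c b x ≈ sum (gaps x)
      slack-gaps x = ≈-trans
        (≈-trans (+-cong ≈-refl (≈-sym (sum-neg λ i → c i * x i)))
                 (≈-sym (∑-distrib-+ (λ i → if S i then digit (v i) else 0ℝ) (λ i → - (c i * x i)))))
        (sum-cong-≋ term)
        where
        vanish : ∀ p → 0ℚ ℚ.+ ℚ.- (0ℚ ℚ.* p) ≡ 0ℚ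
        vanish = solve-∀ ℚ-ring
        term : ∀ i → (if S i then digit (v i) else 0ℝ) - c i * x i ≈ gaps x i
        term i with S i
        ... | true  = gap-affine (v i) (x i)
        ... | false = ≗⇒≈ λ n → vanish (seq (x i) n)

    -- The slack is the sum of the gaps over `S`. These are nonnegative on the cube, so it vanishes
    -- only where every coordinate in `S` agrees with the corner `v`.
    subcube : Face (Cube k)
    subcube = face c b λ {x} x∈ → 0≤-resp-≈ (≈-sym (slack-gaps x)) (0≤sum (0≤gaps x∈))

    ∈subcube⇒ : ∀ {x} → x ∈ points subcube → ∀ i → S i ≡ true → x i ≈ digit (v i)
    ∈subcube⇒ {x} x∈F@(x∈ , _) i Sᵢ = gap≈0⇒≈digit (v i) (subst
      (λ s → (if s then gap (v i) (x i) else 0ℝ) ≈ 0ℝ) Sᵢ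
      (sum≈0⇒≈0 (0≤gaps x∈) (≈-trans (≈-sym (slack-gaps x)) (slack≈0 subcube x∈F)) i))

    ⇒∈subcube : ∀ {x} → x ∈ Cube k → (∀ i → S i ≡ true → x i ≈ digit (v i)) → x ∈ points subcube
    ⇒∈subcube {x} x∈ fixed = ∈points subcube x∈ (≈-trans (slack-gaps x) (sum-zero term))
      where
      term : ∀ i → gaps x i ≈ 0ℝ
      term i with S i in Sᵢ
      ... | true  = ≈digit⇒gap≈0 (v i) (fixed i Sᵢ)
      ... | false = ≈-refl

    subcube-off : ∀ {x} → x ∈ Cube k → ∀ i → S i ≡ true → 0ℝ < gap (v i) (x i) → 0ℝ < slackOf subcube x
    subcube-off {x} x∈ i Sᵢ 0<gap = 0<-resp-≈ (≈-sym (slack-gaps x)) (0<sum (0≤gaps x∈) i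
      (subst (λ s → 0ℝ < (if s then gap (v i) (x i) else 0ℝ)) (sym Sᵢ) 0<gap))

  -- Compare x with the point obtained from it by setting coordinate i to t.
  face-coordinate : ∀ (F : Face (Cube k)) {x} → x ∈ points F → ∀ i {t} → InInterval t →
    0ℝ ≤ normal F i * (x i - t)
  face-coordinate F {x} x∈F@(x∈ , _) i {t} t∈ = 0≤-resp-≈ (begin
    slackOf F y
      ≈⟨ //-rightDividesʳ (sum λ j → normal F j * (y j - x j)) (slackOf F y) ⟨
    (slackOf F y + (sum λ j → normal F j * (y j - x j))) - (sum λ j → normal F j * (y j - x j))
      ≈⟨ +-cong (≈-trans (slack-+ F x y) (slack≈0 F x∈F))
                (-‿cong (≈-trans (sum-single i λ j j≢i → x*0≈0 (x≈y⇒x∙y⁻¹≈ε (unchanged j j≢i)))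
                                 (*-cong ≈-refl (+-cong at-i ≈-refl)))) ⟩
    0ℝ - normal F i * (t - x i)
      ≈⟨ swap (normal F i) t (x i) ⟩
    normal F i * (x i - t) ∎)
    (0≤slack F y∈)
    where
    open ≈-Reasoning
    y : Point k
    y j with j Fin.≟ i
    ... | yes _ = t
    ... | no _  = x j
    y∈ : y ∈ Cube k
    y∈ j with j Fin.≟ i
    ... | yes _ = t∈
    ... | no _  = x∈ j
    at-i : y i ≈ t
    at-i with i Fin.≟ i
    ... | yes _  = ≈-refl
    ... | no i≢i = contradiction refl i≢i
    unchanged : ∀ j → j ≢ i → y j ≈ x j
    unchanged j j≢i with j Fin.≟ i
    ... | yes j≡i = contradiction j≡i j≢i
    ... | no _    = ≈-refl
    ℚ-swap : ∀ p q r → 0ℚ ℚ.+ ℚ.- (p ℚ.* (q ℚ.+ ℚ.- r)) ≡ p ℚ.* (r ℚ.+ ℚ.- q)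
    ℚ-swap = solve-∀ ℚ-ring
    swap : ∀ x y z → 0ℝ - x * (y - z) ≈ x * (z - y)
    swap x y z = ≗⇒≈ λ n → ℚ-swap (seq x n) (seq y n) (seq z n)

  factor-0≤ : ∀ {x y} → 0ℝ ≤ x * y → 0ℝ < y → 0ℝ ≤ x
  factor-0≤ {x} {y} 0≤xy 0<y = ≮0⇒0≤ λ 0<-x → 0≤⇒≮0 0≤xy (0<-resp-≈ (≈-sym (-‿distribˡ-* x y)) (0<* 0<-x 0<y))

  -- The normal is maximal on F. As z could still move towards `digit d` in coordinate `i`, that
  -- coefficient cannot point strictly that way, so the opposite end is at least as good as any `t`.
  slope-opposite : ∀ (F : Face (Cube k)) {z} → z ∈ points F → ∀ i d → 0ℝ < gap d (z i) →
    ∀ {t} → InInterval t → 0ℝ ≤ normal F i * (digit (opposite d) - t)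
  slope-opposite F {z} z∈F i 0F 0<zᵢ (_ , t≤1) = 0≤*
    (factor-0≤ (face-coordinate F z∈F i (digit∈ 0F)) (0<-resp-≈ (≈-sym x-0≈x) 0<zᵢ)) (≤⇒0≤- t≤1)
    where
    x-0≈x : ∀ {x} → x - 0ℝ ≈ x
    x-0≈x = ≈-trans (+-cong ≈-refl -0#≈0#) (+-identityʳ _)
  slope-opposite F {z} z∈F i 1F 0<1-zᵢ {t} (0≤t , _) = 0≤-resp-≈ (≈-sym (swap (normal F i) 0ℝ t)) (0≤*
    (factor-0≤ (0≤-resp-≈ (swap (normal F i) (z i) 1ℝ) (face-coordinate F z∈F i (digit∈ 1F))) 0<1-zᵢ)
    (≤⇒0≤- 0≤t))
    where
    ℚ-swap : ∀ p q r → p ℚ.* (q ℚ.+ ℚ.- r) ≡ ℚ.- p ℚ.* (r ℚ.+ ℚ.- q)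
    ℚ-swap = solve-∀ ℚ-ring
    swap : ∀ x y z → x * (y - z) ≈ - x * (z - y)
    swap x y z = ≗⇒≈ λ n → ℚ-swap (seq x n) (seq y n) (seq z n)

  -- The signs of the normal cannot be decided, so x itself selects the corner: `0 < x i` permits
  -- rounding to 1, `x i < 1` permits rounding to 0, and `<-split` provides one of the two.
  round : ∀ (F : Face (Cube k)) {x} → x ∈ points F → ∃[ v ] (corner v ∈ points F)
  round F {x} x∈F@(x∈ , _) = proj₁ ∘ choice , ascend F x∈F (corner∈ (proj₁ ∘ choice)) (proj₂ ∘ choice)
    where
    choice : ∀ i → ∃[ d ] (0ℝ ≤ normal F i * (digit d - x i))
    choice i = [ (λ 0<xᵢ → 1F , slope-opposite F x∈F i 0F 0<xᵢ (x∈ i))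
               , (λ xᵢ<1 → 0F , slope-opposite F x∈F i 1F (<⇒0<- xᵢ<1) (x∈ i)) ]′
               (<-split (x i) (ℚ.positive⁻¹ 1ℚ))

  cornerFace : (Fin k → Fin 2) → Face (Cube k)
  cornerFace v = subcube v (λ _ → true)

  ∈cornerFace⇒≋ : ∀ v {x} → x ∈ points (cornerFace v) → x ≋ corner v
  ∈cornerFace⇒≋ v x∈ i = ∈subcube⇒ v _ x∈ i refl

  corner∈cornerFace : ∀ v → corner v ∈ points (cornerFace v)
  corner∈cornerFace v = ⇒∈subcube v _ (corner∈ v) λ _ _ → ≈-refl

-- The graph of the cube

funToFin-cong : ∀ {m n} {f g : Fin m → Fin n} → (∀ i → f i ≡ g i) → funToFin f ≡ funToFin g
funToFin-cong {zero}  f≗g = refl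
funToFin-cong {suc m} f≗g = cong₂ combine (f≗g zero) (funToFin-cong (f≗g ∘ suc))

Word : ℕ → Set
Word = Vec (Fin 2)

decode : ∀ {k} → Fin (2 ℕ.^ k) → Word k
decode {k} i = Vec.tabulate (finToFun {2} {k} i)

encode : ∀ {k} → Word k → Fin (2 ℕ.^ k)
encode w = funToFin (Vec.lookup w)

decode-encode : ∀ {k} (w : Word k) → decode (encode w) ≡ w
decode-encode w = trans (Vec.tabulate-cong (Fin.finToFun-funToFin (Vec.lookup w))) (Vec.tabulate∘lookup w)

encode-decode : ∀ {k} (i : Fin (2 ℕ.^ k)) → encode {k} (decode i) ≡ i
encode-decode {k} i = trans (funToFin-cong (Vec.lookup∘tabulate (finToFun {2} {k} i))) (Fin.funToFin-finToFin {k} i)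

WordEdge : ∀ {k} → Rel (Word k) 0ℓ
WordEdge u v = ∃[ d ] (Vec.lookup u d ≢ Vec.lookup v d × (∀ e → e ≡ d ⊎ Vec.lookup u e ≡ Vec.lookup v e))

wordEdge? : ∀ {k} → Decidable (WordEdge {k})
wordEdge? u v = Fin.any? λ d → ¬? (Vec.lookup u d Fin.≟ Vec.lookup v d) ×-dec
  Fin.all? λ e → (e Fin.≟ d) ⊎-dec (Vec.lookup u e Fin.≟ Vec.lookup v e)

CubeEdge : ∀ {k} → Rel (Fin (2 ℕ.^ k)) 0ℓ
CubeEdge {k} i j = WordEdge {k} (decode i) (decode j)

cubeEdge? : ∀ {k} → Decidable (CubeEdge {k})
cubeEdge? {k} i j = wordEdge? {k} (decode i) (decode j)

cubeEdge-irrefl : ∀ {k} → Irreflexive _≡_ (CubeEdge {k})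
cubeEdge-irrefl refl (d , bit≢ , _) = bit≢ refl

bits : ∀ {k} → Fin (2 ℕ.^ k) → Fin k → Fin 2
bits {k} i = Vec.lookup (decode {k} i)

bits-encode : ∀ {k} (v : Fin k → Fin 2) d → bits {k} (encode (Vec.tabulate v)) d ≡ v d
bits-encode v d = trans (cong (λ w → Vec.lookup w d) (decode-encode (Vec.tabulate v))) (Vec.lookup∘tabulate v d)

bits-injective : ∀ k {i j : Fin (2 ℕ.^ k)} → (∀ d → bits {k} i d ≡ bits {k} j d) → i ≡ j
bits-injective k {i} {j} eq = trans (sym (encode-decode {k} i))
  (trans (funToFin-cong eq) (encode-decode {k} j))

bits-differ : ∀ k {i j : Fin (2 ℕ.^ k)} → i ≢ j → ∃[ d ] (bits {k} i d ≢ bits {k} j d)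
bits-differ k {i} {j} i≢j = Fin.¬∀⟶∃¬ k _ (λ d → bits {k} i d Fin.≟ bits {k} j d) (i≢j ∘ bits-injective k)

cubeLabelling : ∀ k → Labelling (Cube k) (CubeEdge {k})
cubeLabelling k = record
  { pt       = λ i → corner (bits {k} i)
  ; pt∈      = λ i → corner∈ (bits {k} i)
  ; tip      = λ i → cornerFace (bits {k} i)
  ; pt∈tip   = λ i → corner∈cornerFace (bits {k} i)
  ; tip-off  = λ i j j≢i → let d , bit≢ = bits-differ k (j≢i ∘ sym) in
      subcube-off (bits {k} i) _ (corner∈ (bits {k} j)) d refl (gap-digit (bits {k} i d) (bits {k} j d) bit≢)
  ; tip-≋    = λ i → ∈cornerFace⇒≋ (bits {k} i)
  ; covering = λ F x∈F → let v , v∈F = round F x∈F in encode (Vec.tabulate v) ,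
      ∈points-resp-≋ F (λ d → ≈-reflexive (cong digit (sym (bits-encode v d)))) (corner∈ (bits {k} (encode (Vec.tabulate v)))) v∈F
  ; edge     = edge
  ; third    = third
  }
  where
  edge : ∀ {i j} → CubeEdge {k} i j → Σ (Face (Cube k)) λ F →
    corner (bits {k} i) ∈ points F × corner (bits {k} j) ∈ points F ×
    points F ⊆ Aff (corner (bits {k} i) ∷ corner (bits {k} j) ∷ [])
  edge {i} {j} (d , bit≢ , rest) = F
    , ⇒∈subcube (bits {k} i) S (corner∈ (bits {k} i)) (λ _ _ → ≈-refl)
    , ⇒∈subcube (bits {k} i) S (corner∈ (bits {k} j)) (λ e Sₑ → ≈-reflexive (cong digit (sym (agree e Sₑ))))
    , λ {x} x∈F → let t₀ , t₁ , t₀+t₁≈1 , x≈ = weights (bits {k} i d) (bits {k} j d) bit≢ (x d) in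
        (t₀ ∷ t₁ ∷ []) , ≈-trans (+-cong ≈-refl (+-identityʳ t₁)) t₀+t₁≈1
      , λ e → ≈-trans (coordinate x∈F t₀ t₁ t₀+t₁≈1 x≈ e) (+-cong ≈-refl (≈-sym (+-identityʳ _)))
    where
    S : Fin k → Bool
    S e = not (does (e Fin.≟ d))
    F = subcube (bits {k} i) S
    agree : ∀ e → S e ≡ true → bits {k} i e ≡ bits {k} j e
    agree e Sₑ with e Fin.≟ d | rest e
    ... | no e≢d | inj₁ e≡d  = contradiction e≡d e≢d
    ... | no e≢d | inj₂ same = same
    weights : ∀ a b → a ≢ b → ∀ x →
      ∃[ t₀ ] ∃[ t₁ ] (t₀ + t₁ ≈ 1ℝ × x ≈ t₀ * digit a + t₁ * digit b)
    weights 0F 0F a≢b x = contradiction refl a≢b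
    weights 1F 1F a≢b x = contradiction refl a≢b
    weights 0F 1F _ x = 1ℝ - x , x , ≗⇒≈ (λ n → total (seq x n)) , ≗⇒≈ λ n → value (seq x n)
      where
      total : ∀ p → (1ℚ ℚ.+ ℚ.- p) ℚ.+ p ≡ 1ℚ
      total = solve-∀ ℚ-ring
      value : ∀ p → p ≡ (1ℚ ℚ.+ ℚ.- p) ℚ.* 0ℚ ℚ.+ p ℚ.* 1ℚ
      value = solve-∀ ℚ-ring
    weights 1F 0F _ x = x , 1ℝ - x , ≗⇒≈ (λ n → total (seq x n)) , ≗⇒≈ λ n → value (seq x n)
      where
      total : ∀ p → p ℚ.+ (1ℚ ℚ.+ ℚ.- p) ≡ 1ℚ
      total = solve-∀ ℚ-ring
      value : ∀ p → p ≡ p ℚ.* 1ℚ ℚ.+ (1ℚ ℚ.+ ℚ.- p) ℚ.* 0ℚ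
      value = solve-∀ ℚ-ring
    coordinate : ∀ {x} → x ∈ points F → ∀ t₀ t₁ → t₀ + t₁ ≈ 1ℝ →
      x d ≈ t₀ * digit (bits {k} i d) + t₁ * digit (bits {k} j d) →
      ∀ e → x e ≈ t₀ * digit (bits {k} i e) + t₁ * digit (bits {k} j e)
    coordinate x∈F t₀ t₁ t₀+t₁≈1 x≈ e with e Fin.≟ d
    ... | yes refl = x≈
    ... | no e≢d = ≈-trans (∈subcube⇒ (bits {k} i) S x∈F e Sₑ) (≈-sym (≈-trans
        (+-cong ≈-refl (*-cong ≈-refl (≈-reflexive (cong digit (sym (agree e Sₑ))))))
        (≈-trans (≈-sym (distribʳ _ t₀ t₁)) (≈-trans (*-cong t₀+t₁≈1 ≈-refl) (*-identityˡ _)))))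
      where
      Sₑ : S e ≡ true
      Sₑ with e Fin.≟ d
      ... | yes e≡d = contradiction e≡d e≢d
      ... | no _    = refl

  -- The corner `l` takes coordinate `d` from `j` and the others from `i`; a second differing
  -- coordinate `e` separates it from `j`. Since `j` lies in the face, its digit at `d` is at least
  -- as good for the normal as that of `i`, so `ascend` leads from `i` to `l`.
  third : ∀ {i j} → i ≢ j → ¬ CubeEdge {k} i j → ∃[ l ] (l ≢ i × l ≢ j ×
    (∀ F → corner (bits {k} i) ∈ points F → corner (bits {k} j) ∈ points F → corner (bits l) ∈ points F))
  third {i} {j} i≢j ¬edge = l
    , (λ l≡i → bit≢ (trans (cong (λ m → bits {k} m d) (sym l≡i)) at-d))
    , (λ l≡j → e-bit≢ (trans (sym (off e e≢d)) (cong (λ m → bits {k} m e) l≡j)))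
    , λ F i∈F j∈F → ascend F i∈F (corner∈ (bits l)) (slope F j∈F)
    where
    d = proj₁ (bits-differ k i≢j)
    bit≢ = proj₂ (bits-differ k i≢j)
    another = Fin.¬∀⟶∃¬ k _ (λ e → (e Fin.≟ d) ⊎-dec (bits {k} i e Fin.≟ bits {k} j e))
      λ rest → ¬edge (d , bit≢ , rest)
    e = proj₁ another
    e≢d = proj₂ another ∘ inj₁
    e-bit≢ = proj₂ another ∘ inj₂
    u : Fin k → Fin 2
    u c with c Fin.≟ d
    ... | yes _ = bits {k} j d
    ... | no _  = bits {k} i c
    l = encode (Vec.tabulate u)
    at-d : bits {k} l d ≡ bits {k} j d
    at-d = trans (bits-encode u d) u-at-d
      where
      u-at-d : u d ≡ bits {k} j d
      u-at-d with d Fin.≟ d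
      ... | yes _  = refl
      ... | no d≢d = contradiction refl d≢d
    off : ∀ c → c ≢ d → bits {k} l c ≡ bits {k} i c
    off c c≢d = trans (bits-encode u c) u-off
      where
      u-off : u c ≡ bits {k} i c
      u-off with c Fin.≟ d
      ... | yes c≡d = contradiction c≡d c≢d
      ... | no _    = refl
    slope : ∀ (F : Face (Cube k)) → corner (bits {k} j) ∈ points F → ∀ c →
      0ℝ ≤ normal F c * (corner (bits l) c - corner (bits {k} i) c)
    slope F j∈F c with c Fin.≟ d
    ... | yes refl = subst (λ b → 0ℝ ≤ normal F d * (digit b - digit (bits {k} i d))) (sym at-d)
                       (face-coordinate F j∈F d (digit∈ (bits {k} i d)))
    ... | no c≢d   = ≈⇒0≤ (x*0≈0 (x≈y⇒x∙y⁻¹≈ε (≈-reflexive (cong digit (off c c≢d)))))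

-- Polytopes that are not cubes

emptyFace : ∀ {n} {P : Subset n} → Face P
emptyFace = face (λ _ → 0ℝ) 1ℝ λ {x} _ → 0≤-resp-≈ (≈-sym (constant x)) (<⇒0≤ 0<1)
  where
  constant : ∀ x → slack (λ _ → 0ℝ) 1ℝ x ≈ 1ℝ
  constant x = ≈-trans (+-cong ≈-refl (≈-trans (-‿cong (sum-zero λ i → zeroˡ (x i))) -0#≈0#)) (+-identityʳ 1ℝ)

∉emptyFace : ∀ {n} {P : Subset n} {x} → ¬ x ∈ points (emptyFace {P = P})
∉emptyFace {x = x} (_ , 0·x≈1) = <-irrefl (≈-trans (≈-sym (sum-zero λ i → zeroˡ (x i))) 0·x≈1) 0<1

IsEmpty : ∀ {n} → Subset n → Set
IsEmpty S = ∀ {x} → ¬ x ∈ S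

-- In a cube, if A is a vertex and no proper face contains both A and B, then
-- B contains the vertex antipodal to A; hence any two such B meet.
module _ {n k : ℕ} {Q : Subset n} (A : Face Q)
  (A-nonempty : ¬ IsEmpty (points A))
  (A-minimal : ∀ (G : Face Q) → G ⊑ A → ¬ IsEmpty (points G) → A ⊑ G) where

  Spanning : Face Q → Set
  Spanning B = ∀ (G : Face Q) → A ⊑ G → B ⊑ G → Q ⊆ points G

  module _ (φ : Face Q → Face (Cube k)) (iso : IsOrderIsomorphism _≗_ _≗_ _⊑_ _⊑_ φ) where

    open IsOrderIsomorphism iso using (mono; cancel; surjective)

    private
      φ⁻¹ : Face (Cube k) → Face Q
      φ⁻¹ H = proj₁ (surjective H)

      φφ⁻¹⊑ : ∀ H → φ (φ⁻¹ H) ⊑ H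
      φφ⁻¹⊑ H = proj₁ (proj₂ (surjective H) ((λ x∈ → x∈) , (λ x∈ → x∈)))

      ⊑φφ⁻¹ : ∀ H → H ⊑ φ (φ⁻¹ H)
      ⊑φφ⁻¹ H = proj₂ (proj₂ (surjective H) ((λ x∈ → x∈) , (λ x∈ → x∈)))

      φ⊑⇒ : ∀ F H → φ F ⊑ H → F ⊑ φ⁻¹ H
      φ⊑⇒ F H φF⊑H = cancel {F} {φ⁻¹ H} λ x∈ → ⊑φφ⁻¹ H (φF⊑H x∈)

      ⇒φ⊑ : ∀ F H → F ⊑ φ⁻¹ H → φ F ⊑ H
      ⇒φ⊑ F H F⊑ x∈ = φφ⁻¹⊑ H (mono {F} {φ⁻¹ H} F⊑ x∈)

      ⊑φ⇒ : ∀ H F → H ⊑ φ F → φ⁻¹ H ⊑ F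
      ⊑φ⇒ H F H⊑φF = cancel {φ⁻¹ H} {F} λ x∈ → H⊑φF (φφ⁻¹⊑ H x∈)

      ⇒⊑φ : ∀ H F → φ⁻¹ H ⊑ F → H ⊑ φ F
      ⇒⊑φ H F ⊑F x∈ = mono {φ⁻¹ H} {F} ⊑F (⊑φφ⁻¹ H x∈)

      -- Emptiness is an order property, namely lying below `emptyFace`, and so it passes through
      -- the isomorphism in both directions.
      φ-empty : ∀ F → IsEmpty (points F) → IsEmpty (points (φ F))
      φ-empty F empty x∈ = ∉emptyFace {P = Cube k}
        (⇒φ⊑ F emptyFace (λ y∈ → contradiction y∈ empty) x∈)

      φ-empty⁻¹ : ∀ F → IsEmpty (points (φ F)) → IsEmpty (points F)
      φ-empty⁻¹ F empty x∈ = ∉emptyFace {P = Q}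
        (cancel {F} {emptyFace} (λ y∈ → contradiction y∈ empty) x∈)

      φ⁻¹-nonempty : ∀ H {x} → x ∈ points H → ¬ IsEmpty (points (φ⁻¹ H))
      φ⁻¹-nonempty H x∈H empty = φ-empty (φ⁻¹ H) empty (⊑φφ⁻¹ H x∈H)

      antipode : (Fin k → Fin 2) → Fin k → Fin 2
      antipode v = opposite ∘ v

      opposite-≉ : ∀ d → ¬ digit (opposite d) ≈ digit d
      opposite-≉ 0F 1≈0 = <-irrefl (≈-sym 1≈0) 0<1
      opposite-≉ 1F 0≈1 = <-irrefl 0≈1 0<1

      facet : (Fin k → Fin 2) → Fin k → Face (Cube k)
      facet v i = subcube v λ j → does (j Fin.≟ i)

      corner⊑ : ∀ v F → corner v ∈ points (φ F) → φ⁻¹ (cornerFace v) ⊑ F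
      corner⊑ v F v∈φF = ⊑φ⇒ (cornerFace v) F λ x∈ →
        ∈points-resp-≋ (φ F) (≋-sym (∈cornerFace⇒≋ v x∈)) (proj₁ x∈) v∈φF

      module _ (v : Fin k → Fin 2) (v∈φA : corner v ∈ points (φ A)) where

        -- The corner pulls back to a nonempty face below A, which by minimality contains A.
        φA⊑v : φ A ⊑ cornerFace v
        φA⊑v = ⇒φ⊑ A (cornerFace v) (A-minimal (φ⁻¹ (cornerFace v))
          (corner⊑ v A v∈φA)
          (φ⁻¹-nonempty (cornerFace v) (corner∈cornerFace v)))

        -- The facet contains `φ A`. If it contained `φ B` too, its preimage would be all of Q, and
        -- the facet would contain every corner, even the antipode of v.
        φ-spanning : ∀ B → Spanning B → ∀ i → ¬ φ B ⊑ facet v i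
        φ-spanning B spans i φB⊑ = opposite-≉ (v i) (∈subcube⇒ v (λ j → does (j Fin.≟ i))
          (φφ⁻¹⊑ (facet v i) (⇒⊑φ (cornerFace (antipode v)) G (λ x∈ → Q⊆G (proj₁ x∈))
                               (corner∈cornerFace (antipode v))))
          i (dec-true (i Fin.≟ i) refl))
          where
          G = φ⁻¹ (facet v i)
          Q⊆G : Q ⊆ points G
          Q⊆G = spans G
            (φ⊑⇒ A (facet v i) λ x∈ → ⇒∈subcube v _ (proj₁ (φA⊑v x∈)) λ j _ → ∈cornerFace⇒≋ v (φA⊑v x∈) j)
            (φ⊑⇒ B (facet v i) φB⊑)

        -- Otherwise, in some coordinate the normal of φ B points away from the
        -- antipode, and φ B lies in the corresponding facet through corner v.
        antipode∈ : ∀ B → Spanning B → ∀ {y} → y ∈ points (φ B) → corner (antipode v) ∈ points (φ B)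
        antipode∈ B spans {y} y∈φB@(y∈ , _) = ascend (φ B) y∈φB (corner∈ (antipode v)) λ i →
          ≮0⇒0≤ λ descends → φ-spanning B spans i λ {z} z∈φB@(z∈ , _) →
            ⇒∈subcube v _ z∈ λ j j≟i → subst (λ j → z j ≈ digit (v j)) (sym (true⇒≡ j≟i))
              (gap≈0⇒≈digit (v i) (0≤∧≯0⇒≈0 (0≤gap (v i) (z∈ i)) λ 0<gap →
                0≤⇒≮0 (slope-opposite (φ B) z∈φB i (v i) 0<gap (y∈ i)) descends))
          where
          true⇒≡ : ∀ {i j : Fin k} → does (j Fin.≟ i) ≡ true → j ≡ i
          true⇒≡ {i} {j} eq with j Fin.≟ i
          ... | yes j≡i = j≡i

    spanning-faces-meet : ∀ B C → ¬ IsEmpty (points B) → ¬ IsEmpty (points C) →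
      Spanning B → Spanning C → ¬ IsEmpty (points B ∩ points C)
    spanning-faces-meet B C B-nonempty C-nonempty B-spans C-spans disjoint =
      -- Points of the three images exist only under double negation; the goal is a contradiction,
      -- so they may be assumed.
      A-nonempty (φ-empty⁻¹ A λ x∈φA →
      B-nonempty (φ-empty⁻¹ B λ y∈φB →
      C-nonempty (φ-empty⁻¹ C λ z∈φC →
        let v , v∈φA = round (φ A) x∈φA
            ā = cornerFace (antipode v)
            ā⊑B = corner⊑ (antipode v) B (antipode∈ v v∈φA B B-spans y∈φB)
            ā⊑C = corner⊑ (antipode v) C (antipode∈ v v∈φA C C-spans z∈φC)
        in φ⁻¹-nonempty ā (corner∈cornerFace (antipode v)) λ x∈ →
             disjoint (ā⊑B x∈ , ā⊑C x∈))))

-- Convex hulls of integer points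

ι-sum : ∀ {m} (t : Vector ℤ m) → ι (sumℤ t) ≈ sum (ι ∘ t)
ι-sum {zero}  t = ≈-refl
ι-sum {suc m} t = ≈-trans (ι-+ (t zero) (sumℤ (t ∘ suc))) (+-cong ≈-refl (ι-sum (t ∘ suc)))

slackℤ : ∀ {n} → Vec ℤ (suc n) → Vector ℤ n → ℤ
slackℤ (b Vec.∷ c) x = b ℤ.- sumℤ λ j → Vec.lookup c j ℤ.* x j

-- An inequality c · x ≤ b is encoded by the vector b ∷ c.
normalOf : ∀ {n} → Vec ℤ (suc n) → Point n
normalOf f j = ι (Vec.lookup (Vec.tail f) j)

offsetOf : ∀ {n} → Vec ℤ (suc n) → ℝ
offsetOf f = ι (Vec.head f)

slack-ι : ∀ {n} (f : Vec ℤ (suc n)) (x : Vector ℤ n) →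
  slack (normalOf f) (offsetOf f) (ι ∘ x) ≈ ι (slackℤ f x)
slack-ι (b Vec.∷ c) x = ≈-sym (≈-trans (ι-+ b (ℤ.- s)) (+-cong ≈-refl
  (≈-trans (ι-neg s) (-‿cong (≈-trans (ι-sum λ j → Vec.lookup c j ℤ.* x j)
    (sum-cong-≋ λ j → ι-* (Vec.lookup c j) (x j)))))))
  where s = sumℤ λ j → Vec.lookup c j ℤ.* x j

ι-combination : ∀ {n m} (α : Vector ℤ m) (x : Vector (Vector ℤ n) m) j →
  ι (sumℤ λ k → α k ℤ.* x k j) ≈ combination (ι ∘ α) (λ k → ι ∘ x k) j
ι-combination α x j = ≈-trans (ι-sum λ k → α k ℤ.* x k j) (sum-cong-≋ λ k → ι-* (α k) (x k j))

AffinelyDependent : ∀ {n m} → Vector ℤ m → Vector (Vector ℤ n) m → Set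
AffinelyDependent α x = sumℤ α ≡ 0ℤ × (∀ j → (sumℤ λ k → α k ℤ.* x k j) ≡ 0ℤ)

affinelyDependent? : ∀ {n m} (α : Vector ℤ m) (x : Vector (Vector ℤ n) m) → Dec (AffinelyDependent α x)
affinelyDependent? α x = (sumℤ α ℤ.≟ 0ℤ) ×-dec
  Fin.all? λ j → (sumℤ λ k → α k ℤ.* x k j) ℤ.≟ 0ℤ

-- Indexing by W instead of Fin m spares exhaustive checks the slow decoding.
module IntegralHull {n m} {W : Set} (x : W → Vector ℤ n) (decode : Fin m → W) (encode : W → Fin m)
  (decode-encode : ∀ w → decode (encode w) ≡ w) (encode-decode : ∀ i → encode (decode i) ≡ i) where

  q : W → Point n
  q w = ι ∘ x w

  p : Vector (Point n) m
  p i = q (decode i)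

  P : Subset n
  P = Conv p

  p-encode : (T : Pred (Point n) 0ℓ) → ∀ {w} → p (encode w) ∈ T → q w ∈ T
  p-encode T {w} = subst (λ v → q v ∈ T) (decode-encode w)

  encode-p : (T : Pred (Point n) 0ℓ) → ∀ {w} → q w ∈ T → p (encode w) ∈ T
  encode-p T {w} = subst (λ v → q v ∈ T) (sym (decode-encode w))

  q∈P : ∀ w → q w ∈ P
  q∈P w = p-encode P (∈Conv p (encode w))

  -- `Q` is arbitrary because this is applied both to faces of `P` and to faces of a facet regarded
  -- as a polytope of its own.
  dependency-faceℤ : ∀ {Q : Subset n} (F : Face Q) {r} (α : Vector ℤ r) (s : Vector W r) →
    AffinelyDependent α (x ∘ s) →
    (∀ i → α i ≡ 0ℤ ⊎ (0ℤ ℤ.≤ α i × q (s i) ∈ Q) ⊎ q (s i) ∈ points F) →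
    ∀ l → 0ℤ ℤ.< α l → q (s l) ∈ Q → q (s l) ∈ points F
  dependency-faceℤ F α s (∑α≡0 , comb≡0) cases l 0<αₗ = dependency-face F (ι ∘ α) (q ∘ s)
    (≈-trans (≈-sym (ι-sum α)) (≈-reflexive (cong ι ∑α≡0)))
    (λ j → ≈-trans (≈-sym (ι-combination α (x ∘ s) j)) (≈-reflexive (cong ι (comb≡0 j))))
    (λ i → [ (λ αᵢ≡0 → inj₁ (≈-reflexive (cong ι αᵢ≡0)))
           , inj₂ ∘ [ (λ (0≤αᵢ , ∈Q) → inj₁ (0≤ι 0≤αᵢ , ∈Q)) , inj₂ ]′ ]′ (cases i))
    l (0<ι 0<αₗ)

  -- Tight vertices satisfy `S`, but members of `S` need not be tight: with `S` always true this is
  -- mere validity of the inequality. Tightness at particular vertices is demanded separately.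
  Exposes : Vec ℤ (suc n) → Pred W 0ℓ → Set
  Exposes f S = ∀ w → (S w × slackℤ f (x w) ≡ 0ℤ) ⊎ 0ℤ ℤ.< slackℤ f (x w)

  module _ (f : Vec ℤ (suc n)) {S : Pred W 0ℓ} (exposes : Exposes f S) where

    exposedFace : Face P
    exposedFace = face (normalOf f) (offsetOf f) (Conv-0≤slack p _ _ λ k →
      0≤-resp-≈ (≈-sym (slack-ι f (x (decode k))))
        ([ (λ (_ , eq) → ≈⇒0≤ (≈-reflexive (cong ι eq))) , (λ 0<s → <⇒0≤ (0<ι 0<s)) ]′ (exposes (decode k))))

    exposed-on : ∀ w → slackℤ f (x w) ≡ 0ℤ → q w ∈ points exposedFace
    exposed-on w eq = ∈points exposedFace (q∈P w) (≈-trans (slack-ι f (x w)) (≈-reflexive (cong ι eq)))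

    exposed-off : ∀ w → 0ℤ ℤ.< slackℤ f (x w) → 0ℝ < slackOf exposedFace (q w)
    exposed-off w 0<s = 0<-resp-≈ (≈-sym (slack-ι f (x w))) (0<ι 0<s)

    exposed⊆Aff : ∀ {r} {y : Vector (Point n) (suc r)} → (∀ w → S w → q w ∈ Aff y) →
      points exposedFace ⊆ Aff y
    exposed⊆Aff {y = y} S⊆Aff = face⊆Aff p exposedFace {q = y} λ k →
      [ (λ (Sₖ , _) → inj₂ (S⊆Aff (decode k) Sₖ)) , (λ 0<s → inj₁ (exposed-off (decode k) 0<s)) ]′
      (exposes (decode k))

  -- A point of the line uv lies on the segment zz′ and differs from z′.
  Crosses : W → W → Vector W 2 → Vector ℤ 4 → Set
  Crosses u v z c = AffinelyDependent c (x ∘ (u ∷ v ∷ z)) × z 0F ≢ u × z 0F ≢ v × 0ℤ ℤ.< c 2F × 0ℤ ℤ.≤ c 3F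

  crosses⇒∈ : ∀ {u v} z c → Crosses u v z c →
    ∀ (F : Face P) → q u ∈ points F → q v ∈ points F → q (z 0F) ∈ points F
  crosses⇒∈ {u} {v} z c (dep , _ , _ , 0<c₂ , 0≤c₃) F u∈F v∈F =
    dependency-faceℤ F c s dep cases 2F 0<c₂ (q∈P (z 0F))
    where
    s : Vector W 4
    s = u ∷ v ∷ z
    cases : ∀ i → c i ≡ 0ℤ ⊎ (0ℤ ℤ.≤ c i × q (s i) ∈ P) ⊎ q (s i) ∈ points F
    cases 0F = inj₂ (inj₂ u∈F)
    cases 1F = inj₂ (inj₂ v∈F)
    cases 2F = inj₂ (inj₁ (ℤ.<⇒≤ 0<c₂ , q∈P (z 0F)))
    cases 3F = inj₂ (inj₁ (0≤c₃ , q∈P (z 1F)))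

  module _ (tipOf : W → Vec ℤ (suc n))
    (tip-exposes : ∀ w → Exposes (tipOf w) (_≡ w) × slackℤ (tipOf w) (x w) ≡ 0ℤ) where

    tipFace : W → Face P
    tipFace w = exposedFace (tipOf w) (proj₁ (tip-exposes w))

    q∈tipFace : ∀ w → q w ∈ points (tipFace w)
    q∈tipFace w = exposed-on (tipOf w) (proj₁ (tip-exposes w)) w (proj₂ (tip-exposes w))

    tipFace-≋ : ∀ w {y} → y ∈ points (tipFace w) → y ≋ q w
    tipFace-≋ w y∈ = Aff-single (q w ∷ []) (exposed⊆Aff (tipOf w) (proj₁ (tip-exposes w))
      {y = q w ∷ []} (λ { v refl → ∈Aff (q w ∷ []) 0F }) y∈)

  module _ {E : Rel W 0ℓ}
    (tipOf : W → Vec ℤ (suc n))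
    (tip-exposes : ∀ w → Exposes (tipOf w) (_≡ w) × slackℤ (tipOf w) (x w) ≡ 0ℤ)
    (edgeOf : W → W → Vec ℤ (suc n))
    (edge-exposes : ∀ u v → E u v → Exposes (edgeOf u v) (λ w → w ≡ u ⊎ w ≡ v) ×
      slackℤ (edgeOf u v) (x u) ≡ 0ℤ × slackℤ (edgeOf u v) (x v) ≡ 0ℤ)
    (crossing : W → W → Vector W 2 × Vector ℤ 4)
    (crossing-crosses : ∀ u v → u ≡ v ⊎ E u v ⊎ Crosses u v (proj₁ (crossing u v)) (proj₂ (crossing u v)))
    where

    hullLabelling : Labelling P (λ i j → E (decode i) (decode j))
    hullLabelling = record
      { pt       = p
      ; pt∈      = ∈Conv p
      ; tip      = tipFace tipOf tip-exposes ∘ decode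
      ; pt∈tip   = q∈tipFace tipOf tip-exposes ∘ decode
      ; tip-off  = λ i j j≢i → exposed-off (tipOf (decode i)) (proj₁ (tip-exposes (decode i))) (decode j)
          ([ (λ (eq , _) → contradiction (decode-injective eq) j≢i) , (λ 0<s → 0<s) ]′
            (proj₁ (tip-exposes (decode i)) (decode j)))
      ; tip-≋    = tipFace-≋ tipOf tip-exposes ∘ decode
      ; covering = face-meets-vertices p
      ; edge     = λ {i} {j} → edge (decode i) (decode j)
      ; third    = third
      }
      where
      decode-injective : ∀ {i j} → decode i ≡ decode j → i ≡ j
      decode-injective {i} {j} eq = trans (sym (encode-decode i)) (trans (cong encode eq) (encode-decode j))
      edge : ∀ u v → E u v → Σ (Face P) λ F → q u ∈ points F × q v ∈ points F × points F ⊆ Aff (q u ∷ q v ∷ [])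
      edge u v e = exposedFace f exposes
        , exposed-on f exposes u (proj₁ (proj₂ (edge-exposes u v e)))
        , exposed-on f exposes v (proj₂ (proj₂ (edge-exposes u v e)))
        , exposed⊆Aff f exposes {y = q u ∷ q v ∷ []} λ
            { w (inj₁ refl) → ∈Aff (q u ∷ q v ∷ []) 0F ; w (inj₂ refl) → ∈Aff (q u ∷ q v ∷ []) 1F }
        where
        f = edgeOf u v
        exposes = proj₁ (edge-exposes u v e)
      third : ∀ {i j} → i ≢ j → ¬ E (decode i) (decode j) → ∃[ l ] (l ≢ i × l ≢ j ×
        (∀ F → p i ∈ points F → p j ∈ points F → p l ∈ points F))
      third {i} {j} i≢j ¬e = choose (crossing-crosses (decode i) (decode j))
        where
        z = proj₁ (crossing (decode i) (decode j))
        c = proj₂ (crossing (decode i) (decode j))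
        choose : decode i ≡ decode j ⊎ E (decode i) (decode j) ⊎ Crosses (decode i) (decode j) z c → _
        choose (inj₁ eq)       = contradiction (decode-injective eq) i≢j
        choose (inj₂ (inj₁ e)) = contradiction e ¬e
        choose (inj₂ (inj₂ crosses@(_ , z≢i , z≢j , _))) = encode (z 0F)
          , (λ l≡i → z≢i (trans (sym (decode-encode (z 0F))) (cong decode l≡i)))
          , (λ l≡j → z≢j (trans (sym (decode-encode (z 0F))) (cong decode l≡j)))
          , λ F i∈F j∈F → encode-p (points F) (crosses⇒∈ z c crosses F i∈F j∈F)

  -- f l is d times the barycentric coordinate at the vertex v l.
  simplex-dimension : ∀ {r} (v : Vector W (suc r)) (f : Vector (Vec ℤ (suc n)) (suc r)) d u → u * ι d ≈ 1ℝ →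
    (∀ l → (∀ k → k ≢ l → slackℤ (f l) (x (v k)) ≡ 0ℤ) × 0ℤ ℤ.< slackℤ (f l) (x (v l))) →
    (∀ w → (sumℤ λ l → slackℤ (f l) (x w)) ≡ d ×
      (∀ j → (sumℤ λ l → slackℤ (f l) (x w) ℤ.* x (v l) j) ≡ d ℤ.* x w j)) →
    HasDimension P r
  simplex-dimension {r} v f d u ud≈1 dual barycentric = q ∘ v , q∈P ∘ v
    , dual⇒independent (q ∘ v) (λ l → normalOf (f l) , offsetOf (f l)
        , (λ k k≢l → ≈-trans (slack-ι (f l) (x (v k))) (≈-reflexive (cong ι (proj₁ (dual l) k k≢l))))
        , 0<-resp-≈ (≈-sym (slack-ι (f l) (x (v l)))) (0<ι (proj₂ (dual l))))
    , λ {y} (w , _ , ∑w≈1 , y≋) → Aff-combination w p {q ∘ v} {y} (∈Aff-v ∘ decode) ∑w≈1 y≋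
    where
    open ≈-Reasoning
    ∈Aff-v : ∀ w → q w ∈ Aff (q ∘ v)
    ∈Aff-v w = (λ l → u * ι (β l)) , (begin
        (sum λ l → u * ι (β l))  ≈⟨ *-distribˡ-sum u (ι ∘ β) ⟨
        u * sum (ι ∘ β)          ≈⟨ *-cong ≈-refl (ι-sum β) ⟨
        u * ι (sumℤ β)           ≡⟨ cong (λ s → u * ι s) (proj₁ (barycentric w)) ⟩
        u * ι d                  ≈⟨ ud≈1 ⟩
        1ℝ                       ∎)
      , λ j → begin
        ι (x w j)                                       ≈⟨ *-identityˡ (ι (x w j)) ⟨
        1ℝ * ι (x w j)                                  ≈⟨ *-cong ud≈1 ≈-refl ⟨
        u * ι d * ι (x w j)                             ≈⟨ *-assoc u (ι d) (ι (x w j)) ⟩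
        u * (ι d * ι (x w j))                           ≈⟨ *-cong ≈-refl (ι-* d (x w j)) ⟨
        u * ι (d ℤ.* x w j)                             ≡⟨ cong (λ s → u * ι s) (proj₂ (barycentric w) j) ⟨
        u * ι (sumℤ λ l → β l ℤ.* x (v l) j)            ≈⟨ *-cong ≈-refl (ι-combination β (x ∘ v) j) ⟩
        u * (sum λ l → ι (β l) * ι (x (v l) j))         ≈⟨ *-distribˡ-sum u (λ l → ι (β l) * ι (x (v l) j)) ⟩
        (sum λ l → u * (ι (β l) * ι (x (v l) j)))       ≈⟨ (sum-cong-≋ λ l → *-assoc u (ι (β l)) (ι (x (v l) j))) ⟨
        (sum λ l → u * ι (β l) * ι (x (v l) j))         ∎
      where
      β : Vector ℤ (suc r)
      β l = slackℤ (f l) (x w)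

  -- The weights ω show that the segment uv meets the interior of the face given by f.
  Spans : Vec ℤ (suc n) → (W → ℤ) → W → W → Set
  Spans f ω u v = AffinelyDependent (ω ∘ decode) (x ∘ decode) ×
    (∀ w → (ω w ≡ 0ℤ × 0ℤ ℤ.< slackℤ f (x w)) ⊎
           (slackℤ f (x w) ≡ 0ℤ × (0ℤ ℤ.< ω w ⊎ w ≡ u ⊎ w ≡ v)))

  module _ (f : Vec ℤ (suc n)) {S : Pred W 0ℓ} (exposes : Exposes f S) where

    private F = exposedFace f exposes

    -- Among the vertices of F, ω can fail to be positive only at u and v, which lie in G; hence the
    -- dependency puts the remaining ones into G as well. A point of F has weight 0 at vertices off
    -- F, so its slack for G is a sum of zeros.
    spans⇒⊆ : ∀ {u v} ω → Spans f ω u v → (G : Face (points F)) →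
      q u ∈ points G → q v ∈ points G → points F ⊆ points G
    spans⇒⊆ {u} {v} ω (dep , split) G u∈G v∈G {y} y∈F@((w , 0≤w , ∑w≈1 , y≋) , _) =
      ∈points G y∈F (≈-trans (slack-affine (normal G) (offset G) w p ∑w≈1 y≋) (sum-zero term))
      where
      cases : ∀ k → ω (decode k) ≡ 0ℤ ⊎ (0ℤ ℤ.≤ ω (decode k) × p k ∈ points F) ⊎ p k ∈ points G
      cases k with split (decode k)
      ... | inj₁ (ω≡0 , _)               = inj₁ ω≡0
      ... | inj₂ (on , inj₁ 0<ω)         = inj₂ (inj₁ (ℤ.<⇒≤ 0<ω , exposed-on f exposes (decode k) on))
      ... | inj₂ (_ , inj₂ (inj₁ k≡u))   = inj₂ (inj₂ (subst (λ w → q w ∈ points G) (sym k≡u) u∈G))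
      ... | inj₂ (_ , inj₂ (inj₂ k≡v))   = inj₂ (inj₂ (subst (λ w → q w ∈ points G) (sym k≡v) v∈G))
      term : ∀ k → w k * slackOf G (p k) ≈ 0ℝ
      term k with split (decode k)
      ... | inj₁ (_ , 0<s) = 0*x≈0 (*-cancel-0< (exposed-off f exposes (decode k) 0<s)
              (≈-trans (*-comm _ (w k)) (face-weights p F y∈F k)))
      ... | inj₂ (on , inj₁ 0<ω) = x*0≈0 (slack≈0 G
              (dependency-faceℤ G (ω ∘ decode) decode dep cases k 0<ω (exposed-on f exposes (decode k) on)))
      ... | inj₂ (_ , inj₂ (inj₁ k≡u)) = x*0≈0 (slack≈0 G (subst (λ w → q w ∈ points G) (sym k≡u) u∈G))
      ... | inj₂ (_ , inj₂ (inj₂ k≡v)) = x*0≈0 (slack≈0 G (subst (λ w → q w ∈ points G) (sym k≡v) v∈G))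

-- The polytope

allWords? : ∀ {k} {Q : Pred (Word k) 0ℓ} → (∀ w → Dec (Q w)) → Dec (∀ w → Q w)
allWords? {zero}  Q? = map′ (λ { q []ᵛ → q }) (λ q → q []ᵛ) (Q? []ᵛ)
allWords? {suc k} Q? = map′ (λ { q (b ∷ᵛ w) → q b w }) (λ q b w → q (b ∷ᵛ w))
  (Fin.all? λ b → allWords? λ w → Q? (b ∷ᵛ w))

_≟ʷ_ : ∀ {k} (u v : Word k) → Dec (u ≡ v)
_≟ʷ_ = Vec.≡-dec Fin._≟_

sign : Fin 2 → ℤ
sign 0F = 1ℤ
sign 1F = -1ℤ

-- (∣x₁∣ = ∣x₂∣ , x₃ , x₄); the first bit selects the inner or outer quadrilateral,
-- and the other two run around it.
profile : Fin 2 → Fin 2 → Fin 2 → ℤ × ℤ × ℤ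
profile 0F 0F 0F = + 1 , + 2 , + 4
profile 0F 0F 1F = + 3 , 0ℤ , + 4
profile 0F 1F 1F = + 1 , -[1+ 1 ] , + 4
profile 0F 1F 0F = + 1 , 0ℤ , -[1+ 1 ]
profile 1F 0F 0F = + 4 , + 1 , + 2
profile 1F 0F 1F = + 4 , 0ℤ , + 3
profile 1F 1F 1F = + 4 , -1ℤ , + 2
profile 1F 1F 0F = + 4 , 0ℤ , -1ℤ

width : Word 5 → ℤ
width (_ ∷ᵛ _ ∷ᵛ t ∷ᵛ a ∷ᵛ b ∷ᵛ []ᵛ) = proj₁ (profile t a b)

coordinates : Word 5 → Vector ℤ 4
coordinates (r ∷ᵛ s ∷ᵛ t ∷ᵛ a ∷ᵛ b ∷ᵛ []ᵛ) = let x , y , z = profile t a b in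
  sign r ℤ.* x ∷ sign s ℤ.* x ∷ y ∷ z ∷ []

open IntegralHull coordinates decode encode decode-encode (encode-decode {5})

ceiling : Vec ℤ 5
ceiling = + 4 ∷ᵛ 0ℤ ∷ᵛ 0ℤ ∷ᵛ 0ℤ ∷ᵛ 1ℤ ∷ᵛ []ᵛ

-- x₄ ≤ 4,  3 ∣x₃∣ - x₄ ≤ 2  and, for i = 1, 2,
-- ∣xᵢ∣ ≤ 4,  ∣xᵢ∣ + ∣x₃∣ + x₄ ≤ 7,  ∣xᵢ∣ + 9 ∣x₃∣ - 3 x₄ ≤ 7
facets : List (Vec ℤ 5)
facets = ceiling ∷ˡ
  (concatMap (λ r → (+ 2 ∷ᵛ 0ℤ ∷ᵛ 0ℤ ∷ᵛ r ℤ.* + 3 ∷ᵛ -1ℤ ∷ᵛ []ᵛ) ∷ˡ []ˡ) signs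
  ++ concatMap (λ (a , b) →
    (+ 4 ∷ᵛ a ∷ᵛ b ∷ᵛ 0ℤ ∷ᵛ 0ℤ ∷ᵛ []ᵛ) ∷ˡ concatMap (λ r →
      (+ 7 ∷ᵛ a ∷ᵛ b ∷ᵛ r ∷ᵛ 1ℤ ∷ᵛ []ᵛ) ∷ˡ
      (+ 7 ∷ᵛ a ∷ᵛ b ∷ᵛ r ℤ.* + 9 ∷ᵛ -[1+ 2 ] ∷ᵛ []ᵛ) ∷ˡ []ˡ) signs) axes)
  where
  signs : List ℤ
  signs = 1ℤ ∷ˡ -1ℤ ∷ˡ []ˡ
  axes : List (ℤ × ℤ)
  axes = concatMap (λ s → (s , 0ℤ) ∷ˡ (0ℤ , s) ∷ˡ []ˡ) signs

supporting : List (Word 5) → Vec ℤ 5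
supporting ws = foldr (Vec.zipWith ℤ._+_) (Vec.replicate 5 0ℤ)
  (filter (λ f → List.all? (λ w → slackℤ f (coordinates w) ℤ.≟ 0ℤ) ws) facets)

tipOf : Word 5 → Vec ℤ 5
tipOf w = supporting (w ∷ˡ []ˡ)

edgeOf : Word 5 → Word 5 → Vec ℤ 5
edgeOf u v = supporting (u ∷ˡ v ∷ˡ []ˡ)

exposes? : ∀ f {S : Pred (Word 5) 0ℓ} → (∀ w → Dec (S w)) → Dec (Exposes f S)
exposes? f S? = allWords? λ w →
  (S? w ×-dec (slackℤ f (coordinates w) ℤ.≟ 0ℤ)) ⊎-dec (0ℤ ℤ.<? slackℤ f (coordinates w))

abstract
  tip-exposes : ∀ w → Exposes (tipOf w) (_≡ w) × slackℤ (tipOf w) (coordinates w) ≡ 0ℤ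
  tip-exposes = toWitness {a? = allWords? λ w → exposes? (tipOf w) (_≟ʷ w)
    ×-dec (slackℤ (tipOf w) (coordinates w) ℤ.≟ 0ℤ)} tt

abstract
  edge-exposes : ∀ u v → WordEdge u v → Exposes (edgeOf u v) (λ w → w ≡ u ⊎ w ≡ v) ×
    slackℤ (edgeOf u v) (coordinates u) ≡ 0ℤ × slackℤ (edgeOf u v) (coordinates v) ≡ 0ℤ
  edge-exposes = toWitness {a? = allWords? λ u → allWords? λ v → wordEdge? u v →-dec
    (exposes? (edgeOf u v) (λ w → (w ≟ʷ u) ⊎-dec (w ≟ʷ v))
      ×-dec (slackℤ (edgeOf u v) (coordinates u) ℤ.≟ 0ℤ)
      ×-dec (slackℤ (edgeOf u v) (coordinates v) ℤ.≟ 0ℤ))} tt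

-- The lines joining corresponding vertices I and O of the two layers with the
-- same signs meet in (±7, ±7, 0, 0) = b O - a I, where a and b are the weights.
coneWeight : Word 5 → ℤ
coneWeight (_ ∷ᵛ _ ∷ᵛ 0F ∷ᵛ 0F ∷ᵛ 1F ∷ᵛ []ᵛ) = + 3
coneWeight (_ ∷ᵛ _ ∷ᵛ 1F ∷ᵛ 0F ∷ᵛ 1F ∷ᵛ []ᵛ) = + 4
coneWeight (_ ∷ᵛ _ ∷ᵛ 0F ∷ᵛ _ ∷ᵛ _ ∷ᵛ []ᵛ) = 1ℤ
coneWeight (_ ∷ᵛ _ ∷ᵛ 1F ∷ᵛ _ ∷ᵛ _ ∷ᵛ []ᵛ) = + 2

flipBit : Fin 5 → Word 5 → Word 5
flipBit d w = Vec.updateAt w d opposite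

-- Here u and v are opposite in one quadrilateral. The outer one is planar, of constant width 4, and
-- its diagonals cross. The inner one is skew, so its diagonals cross segments to vertices with both
-- signs reversed: from (4,4,0,3) to (-4,-4,0,3) for the diagonal through (3,3,0,4), and from
-- (3,3,0,4) to the negated u for the other, up to the signs of the first two coordinates.
diagonal : Word 5 → Word 5 → Vector (Word 5) 2 × Vector ℤ 4
diagonal u@(r ∷ᵛ s ∷ᵛ t ∷ᵛ a ∷ᵛ b ∷ᵛ []ᵛ) v = by t a b
  where
  at : Fin 2 → Fin 2 → Fin 2 → Word 5
  at t a b = r ∷ᵛ s ∷ᵛ t ∷ᵛ a ∷ᵛ b ∷ᵛ []ᵛ
  negate : Word 5 → Word 5
  negate = flipBit 0F ∘ flipBit 1F
  by : Fin 2 → Fin 2 → Fin 2 → _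
  by 0F 0F 1F = at 1F 0F 1F ∷ negate (at 1F 0F 1F) ∷ [] , -[1+ 4 ] ∷ -1ℤ ∷ + 5 ∷ 1ℤ ∷ []
  by 0F 1F 0F = at 1F 0F 1F ∷ negate (at 1F 0F 1F) ∷ [] , -1ℤ ∷ -[1+ 4 ] ∷ + 5 ∷ 1ℤ ∷ []
  by 0F _  _  = at 0F 0F 1F ∷ negate u ∷ []             , -[1+ 2 ] ∷ -1ℤ ∷ + 2 ∷ + 2 ∷ []
  by 1F 0F 1F = at 1F 0F 0F ∷ at 1F 1F 1F ∷ []          , -[1+ 2 ] ∷ -1ℤ ∷ + 2 ∷ + 2 ∷ []
  by 1F 1F 0F = at 1F 0F 0F ∷ at 1F 1F 1F ∷ []          , -1ℤ ∷ -[1+ 2 ] ∷ + 2 ∷ + 2 ∷ []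
  by 1F _  _  = at 1F 0F 1F ∷ at 1F 1F 0F ∷ []          , -[1+ 1 ] ∷ -[1+ 1 ] ∷ + 3 ∷ 1ℤ ∷ []

-- If a reflection exchanges the sides of u and v, the segment uv and its mirror
-- image cross in the mirror; otherwise u and v lie on a common side.
crossing : Word 5 → Word 5 → Vector (Word 5) 2 × Vector ℤ 4
crossing u v =
  -- The mirrored coordinates of u and v are their widths with opposite signs, so the crossed
  -- weights cancel them; in the other coordinates each vertex agrees with its image.
  if differ 0F then flipBit 0F u ∷ flipBit 0F v ∷ [] , ℤ.- width v ∷ ℤ.- width u ∷ width v ∷ width u ∷ [] else
  if differ 1F then flipBit 1F u ∷ flipBit 1F v ∷ [] , ℤ.- width v ∷ ℤ.- width u ∷ width v ∷ width u ∷ [] else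
  -- The signs agree now, so the lines through u and v have the same apex, and the relation equates
  -- its two expressions `b O - a I`.
  if differ 2F then flipBit 2F u ∷ flipBit 2F v ∷ []
    , ℤ.- coneWeight u ∷ ℤ.- coneWeight v ∷ coneWeight (flipBit 2F u) ∷ coneWeight (flipBit 2F v) ∷ [] else
  diagonal u v
  where
  differ : Fin 5 → Bool
  differ d = not (does (Vec.lookup u d Fin.≟ Vec.lookup v d))

crosses? : ∀ u v z c → Dec (Crosses u v z c)
crosses? u v z c = affinelyDependent? c (coordinates ∘ (u ∷ v ∷ z)) ×-dec
  ¬? (z 0F ≟ʷ u) ×-dec ¬? (z 0F ≟ʷ v) ×-dec (0ℤ ℤ.<? c 2F) ×-dec (0ℤ ℤ.≤? c 3F)

abstract
  crossing-crosses : ∀ u v → u ≡ v ⊎ WordEdge u v ⊎ Crosses u v (proj₁ (crossing u v)) (proj₂ (crossing u v))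
  crossing-crosses = toWitness {a? = allWords? λ u → allWords? λ v →
    (u ≟ʷ v) ⊎-dec wordEdge? u v ⊎-dec crosses? u v (proj₁ (crossing u v)) (proj₂ (crossing u v))} tt

P-labelling : Labelling P (CubeEdge {5})
P-labelling = hullLabelling {E = WordEdge} tipOf tip-exposes edgeOf edge-exposes crossing crossing-crosses

-- The simplex `v` is chosen so that its barycentric coordinates become integral when doubled; hence
-- the factor 2 and its inverse ½.
P-dimension : HasDimension P 4
P-dimension = simplex-dimension v f (+ 2) (fromℚ ½) (≗⇒≈ λ _ → refl)
  (toWitness {a? = Fin.all? λ l →
    (Fin.all? λ k → ¬? (k Fin.≟ l) →-dec (slackℤ (f l) (coordinates (v k)) ℤ.≟ 0ℤ))
    ×-dec (0ℤ ℤ.<? slackℤ (f l) (coordinates (v l)))} tt)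
  (toWitness {a? = allWords? λ w →
    ((sumℤ λ l → slackℤ (f l) (coordinates w)) ℤ.≟ + 2)
    ×-dec Fin.all? λ j → (sumℤ λ l → slackℤ (f l) (coordinates w) ℤ.* coordinates (v l) j) ℤ.≟ + 2 ℤ.* coordinates w j} tt)
  where
  v : Vector (Word 5) 5
  v = (0F ∷ᵛ 0F ∷ᵛ 0F ∷ᵛ 0F ∷ᵛ 0F ∷ᵛ []ᵛ)
    ∷ (0F ∷ᵛ 1F ∷ᵛ 0F ∷ᵛ 0F ∷ᵛ 0F ∷ᵛ []ᵛ)
    ∷ (1F ∷ᵛ 1F ∷ᵛ 0F ∷ᵛ 0F ∷ᵛ 1F ∷ᵛ []ᵛ)
    ∷ (1F ∷ᵛ 1F ∷ᵛ 0F ∷ᵛ 0F ∷ᵛ 0F ∷ᵛ []ᵛ)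
    ∷ (1F ∷ᵛ 1F ∷ᵛ 1F ∷ᵛ 0F ∷ᵛ 1F ∷ᵛ []ᵛ) ∷ []
  f : Vector (Vec ℤ 5) 5
  f = (+ 7 ∷ᵛ 0ℤ ∷ᵛ -1ℤ ∷ᵛ 1ℤ ∷ᵛ 1ℤ ∷ᵛ []ᵛ)
    ∷ (0ℤ ∷ᵛ -1ℤ ∷ᵛ 1ℤ ∷ᵛ 0ℤ ∷ᵛ 0ℤ ∷ᵛ []ᵛ)
    ∷ (-[1+ 5 ] ∷ᵛ 0ℤ ∷ᵛ 0ℤ ∷ᵛ 1ℤ ∷ᵛ -[1+ 1 ] ∷ᵛ []ᵛ)
    ∷ (-[1+ 6 ] ∷ᵛ 1ℤ ∷ᵛ 0ℤ ∷ᵛ -[1+ 1 ] ∷ᵛ -1ℤ ∷ᵛ []ᵛ)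
    ∷ (+ 8 ∷ᵛ 0ℤ ∷ᵛ 0ℤ ∷ᵛ 0ℤ ∷ᵛ + 2 ∷ᵛ []ᵛ) ∷ []

-- The facet x₄ = 4 consists of two frusta glued along a square, with sections
-- [-1,1]², [-3,3]² and [-1,1]² at x₃ = 2, 0, -2.  Its vertex (1,1,2) shares no
-- proper face with (-1,-1,-2), nor with (1,1,-2).

bottom middle top : Fin 2 → Fin 2 → Word 5
bottom r s = r ∷ᵛ s ∷ᵛ 0F ∷ᵛ 0F ∷ᵛ 0F ∷ᵛ []ᵛ
middle r s = r ∷ᵛ s ∷ᵛ 0F ∷ᵛ 0F ∷ᵛ 1F ∷ᵛ []ᵛ
top    r s = r ∷ᵛ s ∷ᵛ 0F ∷ᵛ 1F ∷ᵛ 1F ∷ᵛ []ᵛ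

spans? : ∀ f ω u v → Dec (Spans f ω u v)
spans? f ω u v = affinelyDependent? (ω ∘ decode) (coordinates ∘ decode) ×-dec
  allWords? λ w →
    ((ω w ℤ.≟ 0ℤ) ×-dec (0ℤ ℤ.<? slackℤ f (coordinates w))) ⊎-dec
    ((slackℤ f (coordinates w) ℤ.≟ 0ℤ) ×-dec ((0ℤ ℤ.<? ω w) ⊎-dec (w ≟ʷ u) ⊎-dec (w ≟ʷ v)))

-- The origin is the sum of all twelve vertices and of (1,1,2) and (-1,-1,-2).
oppositeWeights : Word 5 → ℤ
oppositeWeights (0F ∷ᵛ 0F ∷ᵛ 0F ∷ᵛ 0F ∷ᵛ 0F ∷ᵛ []ᵛ) = -[1+ 4 ]
oppositeWeights (1F ∷ᵛ 1F ∷ᵛ 0F ∷ᵛ 1F ∷ᵛ 1F ∷ᵛ []ᵛ) = -[1+ 4 ]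
oppositeWeights (_ ∷ᵛ _ ∷ᵛ 1F ∷ᵛ _ ∷ᵛ _ ∷ᵛ []ᵛ)     = 0ℤ
oppositeWeights (_ ∷ᵛ _ ∷ᵛ _ ∷ᵛ 1F ∷ᵛ 0F ∷ᵛ []ᵛ)    = 0ℤ
oppositeWeights _                                   = 1ℤ

-- Four times the relation 3 (1,1,2) + 3 (1,1,-2) = 4 (3,3,0) + 2 (-3,-3,0),
-- plus the sum of the twelve vertices, minus 6 (3,3,0) + 6 (-3,-3,0) = 0.
verticalWeights : Word 5 → ℤ
verticalWeights (0F ∷ᵛ 0F ∷ᵛ 0F ∷ᵛ 0F ∷ᵛ 0F ∷ᵛ []ᵛ) = -[1+ 10 ]
verticalWeights (0F ∷ᵛ 0F ∷ᵛ 0F ∷ᵛ 1F ∷ᵛ 1F ∷ᵛ []ᵛ) = -[1+ 10 ]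
verticalWeights (0F ∷ᵛ 0F ∷ᵛ 0F ∷ᵛ 0F ∷ᵛ 1F ∷ᵛ []ᵛ) = + 11
verticalWeights (1F ∷ᵛ 1F ∷ᵛ 0F ∷ᵛ 0F ∷ᵛ 1F ∷ᵛ []ᵛ) = + 3
verticalWeights (_ ∷ᵛ _ ∷ᵛ 1F ∷ᵛ _ ∷ᵛ _ ∷ᵛ []ᵛ)     = 0ℤ
verticalWeights (_ ∷ᵛ _ ∷ᵛ _ ∷ᵛ 1F ∷ᵛ 0F ∷ᵛ []ᵛ)    = 0ℤ
verticalWeights _                                   = 1ℤ

abstract
  opposite-spans : Spans ceiling oppositeWeights (bottom 0F 0F) (top 1F 1F)
  opposite-spans = toWitness {a? = spans? ceiling oppositeWeights (bottom 0F 0F) (top 1F 1F)} tt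

  vertical-spans : Spans ceiling verticalWeights (bottom 0F 0F) (top 0F 0F)
  vertical-spans = toWitness {a? = spans? ceiling verticalWeights (bottom 0F 0F) (top 0F 0F)} tt

  ceiling-exposes : Exposes ceiling (λ _ → ⊤)
  ceiling-exposes = toWitness {a? = exposes? ceiling λ _ → yes tt} tt

doubleCube : Face P
doubleCube = exposedFace ceiling ceiling-exposes

D : Subset 4
D = points doubleCube

on-doubleCube : ∀ w → slackℤ ceiling (coordinates w) ≡ 0ℤ → q w ∈ D
on-doubleCube = exposed-on ceiling ceiling-exposes

vertexFace : Word 5 → Face D
vertexFace w = record { normal = normal t ; offset = offset t ; valid = λ (x∈P , _) → valid t x∈P }
  where t = tipFace tipOf tip-exposes w

vertexFace-≋ : ∀ w {x} → x ∈ points (vertexFace w) → x ≋ q w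
vertexFace-≋ w ((x∈P , _) , eq) = tipFace-≋ tipOf tip-exposes w (x∈P , eq)

q∈vertexFace : ∀ w → q w ∈ D → q w ∈ points (vertexFace w)
q∈vertexFace w q∈D = q∈D , proj₂ (q∈tipFace tipOf tip-exposes w)

vertexFace-minimal : ∀ w (G : Face D) → G ⊑ vertexFace w → ¬ IsEmpty (points G) → vertexFace w ⊑ G
vertexFace-minimal w G G⊑ nonempty x∈@(x∈D , _) = ∈points G x∈D (0≤∧≯0⇒≈0 (0≤slack G x∈D) λ 0<s →
  nonempty λ y∈G → <-irrefl (≈-sym (≈-trans
    (slack-cong (normal G) (offset G) (≋-trans (vertexFace-≋ w x∈) (≋-sym (vertexFace-≋ w (G⊑ y∈G)))))
    (slack≈0 G y∈G))) 0<s)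

doubleCube-not-cube : ¬ IsCombinatorialCube D
doubleCube-not-cube (k , φ , iso) = spanning-faces-meet (vertexFace a)
  (λ empty → empty a∈) (vertexFace-minimal a) φ iso (vertexFace b) (vertexFace c)
  (λ empty → empty b∈) (λ empty → empty c∈)
  (λ G a⊑ b⊑ → spans⇒⊆ ceiling ceiling-exposes oppositeWeights opposite-spans G (a⊑ a∈) (b⊑ b∈))
  (λ G a⊑ c⊑ → spans⇒⊆ ceiling ceiling-exposes verticalWeights vertical-spans G (a⊑ a∈) (c⊑ c∈))
  -- The first coordinates of b and c are -1 and 1, so their vertex faces cannot meet.
  λ (∈b , ∈c) → <-irrefl (≈-trans (≈-sym (vertexFace-≋ b ∈b 0F)) (vertexFace-≋ c ∈c 0F))
    (mk< 1ℚ (ℚ.positive⁻¹ 1ℚ) 0 λ _ _ → ℚ.*<* (ℤ.+<+ (ℕ.s≤s ℕ.z≤n)))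
  where
  a = bottom 0F 0F
  b = top 1F 1F
  c = top 0F 0F
  a∈ = q∈vertexFace a (on-doubleCube a refl)
  b∈ = q∈vertexFace b (on-doubleCube b refl)
  c∈ = q∈vertexFace c (on-doubleCube c refl)

P-not-cubical : ¬ IsCubical P
P-not-cubical cubical = doubleCube-not-cube (cubical doubleCube (q (bottom 0F 0F) , on-doubleCube (bottom 0F 0F) refl) proper)
  where
  w : Word 5
  w = 0F ∷ᵛ 0F ∷ᵛ 1F ∷ᵛ 0F ∷ᵛ 0F ∷ᵛ []ᵛ
  proper : ¬ P ⊆ D
  proper P⊆D = <-irrefl (≈-sym (slack≈0 doubleCube (P⊆D (q∈P w))))
    (exposed-off ceiling ceiling-exposes w (ℤ.+<+ (ℕ.s≤s ℕ.z≤n)))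

mainTheorem6 : Σ ℕ λ n → Σ (Subset n) λ P →
    IsPolytope P × HasDimension P 4 × GraphIsomorphic P (Cube 5) × ¬ IsCubical P
mainTheorem6 = 4 , P , (2 ℕ.^ 5 , p , (λ x∈ → x∈) , (λ x∈ → x∈)) , P-dimension
  , labellings⇒isomorphic (cubeEdge? {5}) (cubeEdge-irrefl {5}) P-labelling (cubeLabelling 5)
  , P-not-cubical
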